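{- Let $d\ge1$ and let $i,j\ge0$ with $i+j=k$. The number of noncrossing partitions $\pi\in\mathrm{NC}^d_{dk+1}$ of rank $j$ (i.e. with $(dk+1-|\pi|)/d=j$) such that every block of $\pi$ has size $1$ or $d+1$ and every block of the dual partition $\pi'$ has size $1$ or $d+1$ is $$\frac{dk+1}{(dj+1)(di+1)}\binom{dj+1}{i}\binom{di+1}{j}.$$
   Context: A partition of $[n]$ is noncrossing if there are no $i<j<k<\ell$ with $i,k$ in one block and $j,\ell$ in a different block. The Kreweras dual $\pi'$ of a noncrossing partition $\pi$ of $[n]$: place $1,1',2,2',\dots,n,n'$ on a circle in this cyclic order; $\pi'$ is the coarsest partition of $\{1',\dots,n'\}$ such that the blocks of $\pi$ and of $\pi'$ together form a noncrossing partition of these $2n$ points. $\mathrm{NC}^d_n$ is the poset, ordered by refinement, of noncrossing partitions $\pi$ of $[n]$ such that every block of $\pi$ and of $\pi'$ has cardinality congruent to $1$ modulo $d$. $|\pi|$ is the number of blocks of $\pi$. -}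

module Defs where

open import Data.Bool using (Bool; true; false; _∧_; _∨_; not; if_then_else_)
open import Data.Nat using (ℕ; zero; suc; _+_; _*_; _∸_; _≡ᵇ_; _<ᵇ_)
open import Data.Nat.Divisibility using (_∣?_)
open import Data.Fin using (Fin; toℕ)
open import Data.Fin.Properties using (_≟_)
open import Data.List using (List; []; _∷_; [_]; map; concatMap; filterᵇ; length; allFin)
open import Data.Bool.ListAction using (all; any)
open import Data.Vec using (Vec; lookup) renaming ([] to []ᵛ; _∷_ to _∷ᵛ_)
open import Relation.Nullary.Decidable using (⌊_⌋)
open import Data.Product using (_×_; _,_)

vecs : {A : Set} → List A → (k : ℕ) → List (Vec A k)
vecs xs zero    = [ []ᵛ ]
vecs xs (suc k) = concatMap (λ x → map (x ∷ᵛ_) (vecs xs k)) xs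

-- Set partitions of Fin m (Fin m plays the role of [m], 0-indexed).
-- A partition is encoded canonically by the labeling that sends each
-- element to the minimum element of its block.  A vector v is such a
-- labeling iff  v[i] ≤ i  and  v[v[i]] = v[i]  for all i; this gives a
-- bijection between valid labelings and set partitions of Fin m.

Labeling : ℕ → Set
Labeling m = Vec (Fin m) m

isSetPartition : {m : ℕ} → Labeling m → Bool
isSetPartition {m} v =
  all (λ i → (toℕ (lookup v i) <ᵇ suc (toℕ i))
             ∧ ⌊ lookup v (lookup v i) ≟ lookup v i ⌋) (allFin m)

partitions : (m : ℕ) → List (Labeling m)
partitions m = filterᵇ (λ v → isSetPartition v) (vecs (allFin m) m)

sameBlock : {m : ℕ} → Labeling m → Fin m → Fin m → Bool
sameBlock v i j = ⌊ lookup v i ≟ lookup v j ⌋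

blockSize : {m : ℕ} → Labeling m → Fin m → ℕ
blockSize {m} v i = length (filterᵇ (λ j → sameBlock v i j) (allFin m))

-- number of blocks |π| (each block counted via its minimum)
numBlocks : {m : ℕ} → Labeling m → ℕ
numBlocks {m} v = length (filterᵇ (λ i → ⌊ lookup v i ≟ i ⌋) (allFin m))

allBlocks : {m : ℕ} → Labeling m → (ℕ → Bool) → Bool
allBlocks {m} v P = all (λ i → P (blockSize v i)) (allFin m)

refines : {m : ℕ} → Labeling m → Labeling m → Bool
refines {m} τ σ =
  all (λ i → all (λ j → not (sameBlock τ i j) ∨ sameBlock σ i j) (allFin m)) (allFin m)

noCrossing : {P : Set} → List P → (P → ℕ) → (P → P → Bool) → Bool
noCrossing pts pos R =
  all (λ a → all (λ b → all (λ c → all (λ e →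
    not ((pos a <ᵇ pos b) ∧ (pos b <ᵇ pos c) ∧ (pos c <ᵇ pos e)
         ∧ R a c ∧ R b e ∧ not (R a b))) pts) pts) pts) pts

isNoncrossing : {m : ℕ} → Labeling m → Bool
isNoncrossing {m} v = noCrossing (allFin m) toℕ (sameBlock v)

-- Kreweras dual.  The 2n points 1,1',2,2',...,n,n' are encoded as pairs
-- (i , false) = i and (i , true) = i', at linear position 2i and 2i+1.
-- The partition of the 2n points whose blocks are those of π (on the
-- unprimed points) together with those of σ (on the primed points):

Point : ℕ → Set
Point n = Fin n × Bool

points : (n : ℕ) → List (Point n)
points n = concatMap (λ i → (i , false) ∷ (i , true) ∷ []) (allFin n)

position : {n : ℕ} → Point n → ℕ
position (i , false) = 2 * toℕ i
position (i , true)  = suc (2 * toℕ i)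

joinRel : {n : ℕ} → Labeling n → Labeling n → Point n → Point n → Bool
joinRel π σ (i , false) (j , false) = sameBlock π i j
joinRel π σ (i , true)  (j , true)  = sameBlock σ i j
joinRel π σ _           _           = false

jointlyNoncrossing : {n : ℕ} → Labeling n → Labeling n → Bool
jointlyNoncrossing {n} π σ = noCrossing (points n) position (joinRel π σ)

isKrewerasDual : {n : ℕ} → Labeling n → Labeling n → Bool
isKrewerasDual {n} π σ =
  isSetPartition σ ∧ jointlyNoncrossing π σ
  ∧ all (λ τ → not (jointlyNoncrossing π τ) ∨ refines τ σ) (partitions n)

-- s ≡ 1 (mod d), i.e. d divides |s - 1|
congOneMod : ℕ → ℕ → Bool
congOneMod d s = ⌊ d ∣? ((s ∸ 1) + (1 ∸ s)) ⌋

inNCd : (d : ℕ) {n : ℕ} → Labeling n → Bool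
inNCd d {n} π =
  isSetPartition π ∧ isNoncrossing π ∧ allBlocks π (congOneMod d)
  ∧ any (λ σ → isKrewerasDual π σ ∧ allBlocks σ (congOneMod d)) (partitions n)

oneOrDPlusOne : ℕ → ℕ → Bool
oneOrDPlusOne d s = (s ≡ᵇ 1) ∨ (s ≡ᵇ suc d)

-- π ∈ NC^d_n has rank j, every block of π and of its Kreweras dual π'
-- has size 1 or d+1.  Rank j means (n - |π|)/d = j, i.e. |π| + d j = n.
selected : (d j n : ℕ) → Labeling n → Bool
selected d j n π =
  inNCd d π ∧ ((numBlocks π + d * j) ≡ᵇ n)
  ∧ allBlocks π (oneOrDPlusOne d)
  ∧ any (λ σ → isKrewerasDual π σ ∧ allBlocks σ (oneOrDPlusOne d)) (partitions n)

countSelected : (d j n : ℕ) → ℕ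
countSelected d j n = length (filterᵇ (selected d j n) (partitions n))

{-# OPTIONS --safe #-}
-- Together, the blocks of π and of its Kreweras dual are the vertices of a bicoloured plane tree with an edge for each
-- element of [n].  Read along the 2n + 1 positions n′, 1, 1′, 2, 2′, …, n, n′, this tree is traced by a stack machine
-- that makes a binary choice, small or large, whenever it opens a block; everything else is forced, since after a
-- position whose block is not exhausted a new block must open, and otherwise the innermost open block must resume.
-- Hence the partitions correspond to the accepted words with j large black and i large white blocks.  Their number
-- is the coefficient of xʲ yⁱ in A B, where A = 1 + x Bᵈ and B = 1 + y Aᵈ, and it is computed by checking that
-- Good's closed formula for the coefficients of Aʳ Bˢ satisfies the recursion A · Aʳ Bˢ = Aʳ Bˢ + x Aʳ Bˢ⁺ᵈ.
module Submission where

open import Defs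
open import Data.Bool using (Bool; true; false; not; if_then_else_; T; T?; _∧_; _∨_)
open import Data.Bool.ListAction using (all; any)
open import Data.Bool.Properties using (not-involutive)
open import Data.Empty using (⊥; ⊥-elim)
open import Data.Fin using (Fin; toℕ; fromℕ<)
open import Data.Fin.Properties using (toℕ<n; toℕ-injective; toℕ-fromℕ<) renaming (_≟_ to _≟ᶠ_)
open import Data.List using (List; []; _∷_; [_]; map; _++_; length; filterᵇ; allFin; tabulate; concatMap)
open import Data.List.Properties using (length-map; length-++; length-++-comm) renaming (∷-injectiveʳ to ∷ᴸ-injectiveʳ)
open import Data.List.Membership.Propositional using (_∈_)
open import Data.List.Membership.Propositional.Properties
  using (∈-map⁺; ∈-map⁻; ∈-++⁺ˡ; ∈-++⁺ʳ; ∈-++⁻; ∈-∃++; ∈-allFin; ∈-concatMap⁺; ∈-concatMap⁻; ∈-filter⁺; ∈-filter⁻)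
import Data.List.Relation.Unary.All as All
open import Data.List.Relation.Unary.All using ([]; _∷_)
open import Data.List.Relation.Unary.AllPairs using ([]; _∷_)
import Data.List.Relation.Unary.Any as Any
open import Data.List.Relation.Unary.Any using (here; there)
open import Data.List.Relation.Unary.Unique.Propositional using (Unique)
import Data.List.Relation.Unary.Unique.Propositional.Properties as Uniq
open import Data.Nat using (ℕ; zero; suc; pred; _+_; _*_; _≤_; _<_; z≤n; s≤s; _≡ᵇ_; _<ᵇ_)
open import Data.Nat.Combinatorics using (_C_; nCk+nC[k+1]≡[n+1]C[k+1]; nCk≡nC[n∸k]; nCn≡1; k>n⇒nCk≡0)
open import Data.Nat.Divisibility using (_∣_; _∣?_; _∣0; ∣-refl)
open import Data.Nat.Properties
open import Data.Nat.Tactic.RingSolver using (solve-∀)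
open import Data.Product using (_×_; _,_; proj₁; proj₂; ∃-syntax; Σ-syntax)
open import Data.Sum using (_⊎_; inj₁; inj₂)
open import Data.Vec using (Vec; lookup) renaming ([] to []ᵛ; _∷_ to _∷ᵛ_; tabulate to tabulateᵛ)
open import Data.Vec.Properties using (lookup∘tabulate; tabulate∘lookup; tabulate-cong; ∷-injectiveˡ; ∷-injectiveʳ)
open import Function using (_∘_; case_of_)
open import Relation.Binary.Definitions using (tri<; tri≈; tri>)
open import Relation.Binary.PropositionalEquality hiding ([_])
open import Relation.Nullary using (¬_; Dec; yes; no)
open import Relation.Nullary.Decidable using (_×-dec_; _→-dec_; does; dec-true; dec-false; ⌊_⌋; toWitness; fromWitness)
open import Relation.Unary using (Decidable)

-- The definition makes the Kreweras dual the coarsest among all labelings, which cannot be tested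
-- while reading from left to right. It is therefore replaced by the relation `K` on gaps, which
-- depends on π alone, and this in turn by a local law on the interleaved positions: `x + 1` opens a
-- block if and only if the block of `x` occurs again. The equivalence of this law with coarseness
-- is the combinatorial core. Listing n′ at both ends turns the circle into a line whose root block
-- is open from the outset. The numbers of large blocks are recovered from the partition: d points
-- of each large black block are not minima, so the rank is the number of large black blocks; each
-- large block adds 2d positions, so the length then gives the white ones. Labelings and words are
-- matched by a relation that is total and injective in both directions, which is all that counting
-- requires.

-- Binomial identities and Good's coefficient formula

nC0≡1 : ∀ n → n C 0 ≡ 1
nC0≡1 n = trans (nCk≡nC[n∸k] {0} {n} z≤n) (nCn≡1 n)

absorption : ∀ n k → suc k * (suc n C suc k) ≡ suc n * (n C k)
absorption zero zero = refl
absorption zero (suc k) = trans (cong (suc (suc k) *_) (k>n⇒nCk≡0 {1} {suc (suc k)} (s≤s (s≤s z≤n))))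
  (trans (*-zeroʳ (suc (suc k))) (sym (trans (*-identityˡ _) (k>n⇒nCk≡0 {0} {suc k} (s≤s z≤n)))))
absorption (suc n) zero = begin
  1 * (suc (suc n) C 1)              ≡⟨ *-identityˡ _ ⟩
  suc (suc n) C 1                    ≡⟨ nCk+nC[k+1]≡[n+1]C[k+1] (suc n) 0 ⟨
  suc n C 0 + suc n C 1              ≡⟨ cong₂ _+_ (nC0≡1 (suc n)) (trans (sym (*-identityˡ _)) (absorption n 0)) ⟩
  1 + suc n * (n C 0)                ≡⟨ cong (λ t → 1 + suc n * t) (trans (nC0≡1 n) (sym (nC0≡1 (suc n)))) ⟩
  1 + suc n * (suc n C 0)            ≡⟨ cong (_+ suc n * (suc n C 0)) (nC0≡1 (suc n)) ⟨
  suc n C 0 + suc n * (suc n C 0)    ∎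
  where open ≡-Reasoning
absorption (suc n) (suc k) = begin
  suc (suc k) * (suc (suc n) C suc (suc k))
    ≡⟨ cong (suc (suc k) *_) (nCk+nC[k+1]≡[n+1]C[k+1] (suc n) (suc k)) ⟨
  suc (suc k) * (suc n C suc k + suc n C suc (suc k))
    ≡⟨ *-distribˡ-+ (suc (suc k)) (suc n C suc k) _ ⟩
  (suc n C suc k + suc k * (suc n C suc k)) + suc (suc k) * (suc n C suc (suc k))
    ≡⟨ cong₂ (λ u v → (suc n C suc k + u) + v) (absorption n k) (absorption n (suc k)) ⟩
  (suc n C suc k + suc n * (n C k)) + suc n * (n C suc k)
    ≡⟨ +-assoc (suc n C suc k) _ _ ⟩
  suc n C suc k + (suc n * (n C k) + suc n * (n C suc k))
    ≡⟨ cong (suc n C suc k +_) (*-distribˡ-+ (suc n) (n C k) _) ⟨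
  suc n C suc k + suc n * (n C k + n C suc k)
    ≡⟨ cong (λ t → suc n C suc k + suc n * t) (nCk+nC[k+1]≡[n+1]C[k+1] n k) ⟩
  suc n C suc k + suc n * (suc n C suc k) ∎
  where open ≡-Reasoning

-- Let A = 1 + x Bᵈ and B = 1 + y Aᵈ.  By Good's form of Lagrange inversion the coefficient of xᵃ yᵇ in Aʳ Bˢ is
--   C(r+db, a) C(s+da, b) − d² C(r+db−1, a−1) C(s+da−1, b−1);
-- ForestNumber L r s a b says that L has this value, with the subtraction moved to the other side.
module Forests (e : ℕ) where

  d = suc e

  main : (r s a b : ℕ) → ℕ
  main r s a b = ((r + d * b) C a) * ((s + d * a) C b)

  correction : (r s a b : ℕ) → ℕ
  correction r s zero    b       = 0
  correction r s (suc a) zero    = 0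
  correction r s (suc a) (suc b) = d * d * (((r + (e + d * b)) C a) * ((s + (e + d * a)) C b))

  ForestNumber : (L r s a b : ℕ) → Set
  ForestNumber L r s a b = L + correction r s a b ≡ main r s a b

  r+d*suc : ∀ r b → r + d * suc b ≡ suc (r + (e + d * b))
  r+d*suc r b = trans (cong (r +_) (*-suc d b)) (+-suc r (e + d * b))

  forest-swap : ∀ {L} r s a b → ForestNumber L r s a b → ForestNumber L s r b a
  forest-swap {L} r s a b p = trans (cong (L +_) (swap a b)) (trans p (*-comm ((r + d * b) C a) _))
    where
    swap : ∀ a b → correction s r b a ≡ correction r s a b
    swap zero zero = refl
    swap zero (suc b) = refl
    swap (suc a) zero = refl
    swap (suc a) (suc b) = cong (d * d *_) (*-comm ((s + (e + d * a)) C b) _)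

  -- At x = 0 the series A is 1, so the exponent r does not matter: without large blocks of this
  -- colour every opening is a singleton.
  forest-leaf : ∀ {L} r s b → ForestNumber L r s 0 b → ForestNumber L (suc r) s 0 b
  forest-leaf r s b p = trans p (cong (_* ((s + d * 0) C b)) (trans (nC0≡1 (r + d * b)) (sym (nC0≡1 (suc (r + d * b))))))

  pascal-step : ∀ L₁ L₂ c₁ c₂ x₁ x₂ y c x → L₁ + c₁ ≡ x₁ * y → L₂ + c₂ ≡ x₂ * y →
                c ≡ c₁ + c₂ → x₂ + x₁ ≡ x → (L₁ + L₂) + c ≡ x * y
  pascal-step L₁ L₂ c₁ c₂ x₁ x₂ y _ _ p q refl refl = begin
    (L₁ + L₂) + (c₁ + c₂) ≡⟨ eq L₁ L₂ c₁ c₂ ⟩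
    (L₂ + c₂) + (L₁ + c₁) ≡⟨ cong₂ _+_ q p ⟩
    x₂ * y + x₁ * y       ≡⟨ *-distribʳ-+ y x₂ x₁ ⟨
    (x₂ + x₁) * y         ∎
    where
    open ≡-Reasoning
    eq : ∀ a b c d → (a + b) + (c + d) ≡ (b + d) + (a + c)
    eq = solve-∀

  -- The second binomial of `main` is the same in all three terms, because raising s by d makes up
  -- for lowering the exponent of x by one. Pascal's rule on the first binomial then suffices, and
  -- the corrections split in the same way.
  forest-node : ∀ {L₁ L₂} r s a b → ForestNumber L₁ r s (suc a) b → ForestNumber L₂ r (d + s) a b →
                ForestNumber (L₁ + L₂) (suc r) s (suc a) b
  forest-node {L₁} {L₂} r s a b p q = pascal-step L₁ L₂ (correction r s (suc a) b) (correction r (d + s) a b)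
      ((r + d * b) C suc a) ((r + d * b) C a) ((s + d * suc a) C b)
      (correction (suc r) s (suc a) b) (suc (r + d * b) C suc a) p
      (trans q (cong (λ t → ((r + d * b) C a) * (t C b)) shift))
      (corr a b) (nCk+nC[k+1]≡[n+1]C[k+1] (r + d * b) a)
    where
    shift : (d + s) + d * a ≡ s + d * suc a
    shift = trans (cong (_+ d * a) (+-comm d s)) (trans (+-assoc s d (d * a)) (cong (s +_) (sym (*-suc d a))))
    factor : ∀ u x y z → u * ((x + y) * z) ≡ u * (y * z) + u * (x * z)
    factor = solve-∀
    corr : ∀ a b → correction (suc r) s (suc a) b ≡ correction r s (suc a) b + correction r (d + s) a b
    corr zero    zero    = refl
    corr (suc a) zero    = refl
    corr zero    (suc b) = trans
      (cong (λ t → d * d * (t * ((s + (e + d * 0)) C b)))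
        (trans (nC0≡1 (suc r + (e + d * b))) (sym (nC0≡1 (r + (e + d * b))))))
      (sym (+-identityʳ _))
    corr (suc a) (suc b) = begin
      d * d * ((suc (r + (e + d * b)) C suc a) * ((s + (e + d * suc a)) C b))
        ≡⟨ cong (λ t → d * d * (t * ((s + (e + d * suc a)) C b))) (nCk+nC[k+1]≡[n+1]C[k+1] (r + (e + d * b)) a) ⟨
      d * d * (((r + (e + d * b)) C a + (r + (e + d * b)) C suc a) * ((s + (e + d * suc a)) C b))
        ≡⟨ factor (d * d) ((r + (e + d * b)) C a) ((r + (e + d * b)) C suc a) ((s + (e + d * suc a)) C b) ⟩
      correction r s (suc (suc a)) (suc b) + d * d * (((r + (e + d * b)) C a) * ((s + (e + d * suc a)) C b))
        ≡⟨ cong (λ t → correction r s (suc (suc a)) (suc b) + d * d * (((r + (e + d * b)) C a) * (t C b))) (shift′ a) ⟩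
      _ ∎
      where
      open ≡-Reasoning
      lem : ∀ s e x → s + (e + (suc e + x)) ≡ (suc e + s) + (e + x)
      lem = solve-∀
      shift′ : ∀ a → s + (e + d * suc a) ≡ (d + s) + (e + d * a)
      shift′ a = trans (cong (λ t → s + (e + t)) (*-suc d a)) (lem s e (d * a))

  forest-empty : ForestNumber 1 0 0 0 0
  forest-empty = sym (cong₂ _*_ (nC0≡1 (d * 0)) (nC0≡1 (d * 0)))

  d*0<suc : ∀ a → (0 + d * 0) C suc a ≡ 0
  d*0<suc a = k>n⇒nCk≡0 (subst (_< suc a) (sym (*-zeroʳ d)) (s≤s z≤n))

  -- A⁰ B⁰ = 1 has no further coefficients, so the two products in Good's formula must cancel. After
  -- multiplication by `suc a * suc b`, absorption in both binomials shows that they do.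
  forest-none : ∀ a b → 0 < a + b → ForestNumber 0 0 0 a b
  forest-none zero (suc b) _ = sym (trans (cong (((0 + d * suc b) C 0) *_) (d*0<suc b)) (*-zeroʳ ((0 + d * suc b) C 0)))
  forest-none (suc a) zero _ = sym (cong (_* ((0 + d * suc a) C 0)) (d*0<suc a))
  forest-none (suc a) (suc b) _ = *-cancelˡ-≡ _ _ (suc a * suc b) (begin
    suc a * suc b * (d * d * (u * v))
      ≡⟨ eq₁ (suc a) (suc b) d u v ⟩
    (d * suc b * u) * (d * suc a * v)
      ≡⟨ cong₂ (λ x y → (x * u) * (y * v)) (r+d*suc 0 b) (r+d*suc 0 a) ⟩
    (suc (e + d * b) * u) * (suc (e + d * a) * v)
      ≡⟨ cong₂ _*_ (absorption (e + d * b) a) (absorption (e + d * a) b) ⟨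
    (suc a * (suc (e + d * b) C suc a)) * (suc b * (suc (e + d * a) C suc b))
      ≡⟨ cong₂ (λ x y → (suc a * (x C suc a)) * (suc b * (y C suc b))) (r+d*suc 0 b) (r+d*suc 0 a) ⟨
    (suc a * ((d * suc b) C suc a)) * (suc b * ((d * suc a) C suc b))
      ≡⟨ eq₂ (suc a) (suc b) ((d * suc b) C suc a) ((d * suc a) C suc b) ⟩
    suc a * suc b * (((d * suc b) C suc a) * ((d * suc a) C suc b)) ∎)
    where
    open ≡-Reasoning
    u = (e + d * b) C a
    v = (e + d * a) C b
    eq₁ : ∀ a b d u v → a * b * (d * d * (u * v)) ≡ (d * b * u) * (d * a * v)
    eq₁ = solve-∀
    eq₂ : ∀ a b u v → (a * u) * (b * v) ≡ a * b * (u * v)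
    eq₂ = solve-∀

  -- Absorption turns the lowered binomials of the correction into those of the main term at the
  -- cost of the factors d j + 1 and d i + 1; these become the denominators of the closed form.
  correction-absorb : ∀ j i → correction 1 1 j i * ((d * j + 1) * (d * i + 1)) ≡ d * d * (i * j) * main 1 1 j i
  correction-absorb zero i = cong (_* main 1 1 0 i) (sym (trans (cong (d * d *_) (*-zeroʳ i)) (*-zeroʳ (d * d))))
  correction-absorb (suc j) zero = cong (_* main 1 1 (suc j) 0) (sym (*-zeroʳ (d * d)))
  correction-absorb (suc j) (suc i) = begin
    d * d * ((suc (e + d * i) C j) * (suc (e + d * j) C i)) * ((d * suc j + 1) * (d * suc i + 1))
      ≡⟨ cong₂ (λ x y → d * d * ((x C j) * (y C i)) * ((d * suc j + 1) * (d * suc i + 1))) (r+d*suc 0 i) (r+d*suc 0 j) ⟨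
    d * d * (((d * suc i) C j) * ((d * suc j) C i)) * ((d * suc j + 1) * (d * suc i + 1))
      ≡⟨ eq₁ (d * d) ((d * suc i) C j) ((d * suc j) C i) (d * suc j) (d * suc i) ⟩
    d * d * ((suc (d * suc i) * ((d * suc i) C j)) * (suc (d * suc j) * ((d * suc j) C i)))
      ≡⟨ cong₂ (λ x y → d * d * (x * y)) (absorption (d * suc i) j) (absorption (d * suc j) i) ⟨
    d * d * ((suc j * (suc (d * suc i) C suc j)) * (suc i * (suc (d * suc j) C suc i)))
      ≡⟨ eq₂ (d * d) (suc j) (suc (d * suc i) C suc j) (suc i) (suc (d * suc j) C suc i) ⟩
    d * d * (suc i * suc j) * main 1 1 (suc j) (suc i) ∎
    where
    open ≡-Reasoning
    eq₁ : ∀ c u v x y → c * (u * v) * ((x + 1) * (y + 1)) ≡ c * ((suc y * u) * (suc x * v))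
    eq₁ = solve-∀
    eq₂ : ∀ c j u i v → c * ((j * u) * (i * v)) ≡ c * (i * j) * (u * v)
    eq₂ = solve-∀

  -- The numerator is (d j + 1)(d i + 1) - d² i j = d (i + j) + 1: what remains of the main term
  -- once the correction is taken off.
  forest-closed : ∀ L i j → ForestNumber L 1 1 j i →
    L * ((d * j + 1) * (d * i + 1)) ≡ (d * (i + j) + 1) * ((d * j + 1) C i) * ((d * i + 1) C j)
  forest-closed L i j p = +-cancelʳ-≡ (d * d * (i * j) * main 1 1 j i) _ _ (begin
    L * D + d * d * (i * j) * main 1 1 j i  ≡⟨ cong (L * D +_) (correction-absorb j i) ⟨
    L * D + correction 1 1 j i * D          ≡⟨ *-distribʳ-+ D L (correction 1 1 j i) ⟨
    (L + correction 1 1 j i) * D            ≡⟨ cong (_* D) p ⟩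
    main 1 1 j i * D                        ≡⟨ eq d i j (suc (d * i) C j) (suc (d * j) C i) ⟩
    (d * (i + j) + 1) * (suc (d * j) C i) * (suc (d * i) C j) + d * d * (i * j) * main 1 1 j i
      ≡⟨ cong₂ (λ x y → (d * (i + j) + 1) * (x C i) * (y C j) + d * d * (i * j) * main 1 1 j i)
           (+-comm 1 (d * j)) (+-comm 1 (d * i)) ⟩
    (d * (i + j) + 1) * ((d * j + 1) C i) * ((d * i + 1) C j) + d * d * (i * j) * main 1 1 j i ∎)
    where
    open ≡-Reasoning
    D = (d * j + 1) * (d * i + 1)
    eq : ∀ d i j u v → u * v * ((d * j + 1) * (d * i + 1)) ≡ (d * (i + j) + 1) * v * u + d * d * (i * j) * (u * v)
    eq = solve-∀

-- Counting on intervals of positions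

bit : Bool → ℕ
bit true  = 1
bit false = 0

cnt : (ℕ → Bool) → ℕ → ℕ → ℕ
cnt P p zero    = 0
cnt P p (suc f) = bit (P p) + cnt P (suc p) f

≡ᵇ-true : ∀ {m n} → m ≡ n → (m ≡ᵇ n) ≡ true
≡ᵇ-true {m} {n} eq with m ≡ᵇ n | ≡⇒≡ᵇ m n eq
... | true | _ = refl

≡ᵇ-false : ∀ {m n} → m ≢ n → (m ≡ᵇ n) ≡ false
≡ᵇ-false {m} {n} neq with m ≡ᵇ n | ≡ᵇ⇒≡ m n
... | false | _ = refl
... | true  | f = ⊥-elim (neq (f _))

≡ᵇ-sound : ∀ {m n} → (m ≡ᵇ n) ≡ true → m ≡ n
≡ᵇ-sound {m} {n} eq = ≡ᵇ⇒≡ m n (subst T (sym eq) _)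

shift-< : ∀ {p f y} → y < p + suc f → y < suc p + f
shift-< {p} {f} {y} = subst (y <_) (+-suc p f)

cnt-cong : ∀ {P Q} p f → (∀ y → p ≤ y → y < p + f → P y ≡ Q y) → cnt P p f ≡ cnt Q p f
cnt-cong p zero    h = refl
cnt-cong p (suc f) h = cong₂ _+_ (cong bit (h p ≤-refl (m<m+n p (s≤s z≤n))))
  (cnt-cong (suc p) f λ y p<y y< → h y (<⇒≤ p<y) (subst (y <_) (sym (+-suc p f)) y<))

cnt-zero : ∀ {P} p f → (∀ y → p ≤ y → y < p + f → P y ≡ false) → cnt P p f ≡ 0
cnt-zero {P} p f h = trans (cnt-cong p f h) (const-false p f)
  where
  const-false : ∀ p f → cnt (λ _ → false) p f ≡ 0
  const-false p zero    = refl
  const-false p (suc f) = const-false (suc p) f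

cnt-zero⁻ : ∀ {P} p f → cnt P p f ≡ 0 → ∀ {y} → p ≤ y → y < p + f → P y ≡ true → ⊥
cnt-zero⁻ p zero    c {y} p≤y y< _ = <⇒≱ y< (subst (_≤ y) (sym (+-identityʳ p)) p≤y)
cnt-zero⁻ {P} p (suc f) c {y} p≤y y< Py with m≤n⇒m<n∨m≡n p≤y
... | inj₂ refl rewrite Py = case c of λ ()
... | inj₁ p<y = cnt-zero⁻ (suc p) f (m+n≡0⇒n≡0 (bit (P p)) c) p<y (shift-< y<) Py

cnt-pos⁻ : ∀ {P} p f {c} → cnt P p f ≡ suc c → ∃[ y ] p ≤ y × y < p + f × P y ≡ true
cnt-pos⁻ {P} p (suc f) c with P p in eq
... | true  = p , ≤-refl , m<m+n p (s≤s z≤n) , eq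
... | false with cnt-pos⁻ (suc p) f c
...   | y , p<y , y< , Py = y , <⇒≤ p<y , subst (y <_) (sym (+-suc p f)) y< , Py

cnt-++ : ∀ P p f g → cnt P p (f + g) ≡ cnt P p f + cnt P (p + f) g
cnt-++ P p zero    g = cong (λ t → cnt P t g) (sym (+-identityʳ p))
cnt-++ P p (suc f) g = trans (cong (bit (P p) +_) (trans (cnt-++ P (suc p) f g)
  (cong (λ t → cnt P (suc p) f + cnt P t g) (sym (+-suc p f))))) (sym (+-assoc (bit (P p)) _ _))

-- Odd positions are the points of [n], called black; even positions are the gaps, called white.
colour : ℕ → Bool
colour zero    = false
colour (suc n) = not (colour n)

remaining : (ℕ → ℕ) → ℕ → ℕ → ℕ → ℕ
remaining V z p f = cnt (λ x → V x ≡ᵇ z) p f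

remaining-hit : ∀ V {z} p f → V p ≡ z → remaining V z p (suc f) ≡ suc (remaining V z (suc p) f)
remaining-hit V {z} p f eq rewrite ≡ᵇ-true eq = refl

remaining-miss : ∀ V {z} p f → V p ≢ z → remaining V z p (suc f) ≡ remaining V z (suc p) f
remaining-miss V {z} p f neq rewrite ≡ᵇ-false neq = refl

-- Planar labellings and the stack machine

Frame = ℕ × ℕ

data Mode : Set where
  opening resuming : Mode

module Machine (e : ℕ) where
  open Forests e public

  OneOrDPlusOne : ℕ → Set
  OneOrDPlusOne s = (s ≡ 1) ⊎ (s ≡ suc d)

  -- The labelling V sends each position 0 … M to the least position of its block.  The two fields about new blocks
  -- say that the blocks of the two colours are as coarse as noncrossing allows: each is the Kreweras dual of the
  -- other.  Block sizes ignore position 0, which duplicates position M.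
  record Planar (V : ℕ → ℕ) (M : ℕ) : Set where
    field
      le       : ∀ {x} → x ≤ M → V x ≤ x
      idem     : ∀ {x} → x ≤ M → V (V x) ≡ V x
      coloured : ∀ {x} → x ≤ M → colour (V x) ≡ colour x
      nc       : ∀ {x y} → x < y → y ≤ M → V x < V y → V y ≤ x → ⊥
      open⇒new : ∀ {x y} → x < y → y ≤ M → V y ≡ V x → V (suc x) ≡ suc x
      new⇒open : ∀ {x} → x < M → V (suc x) ≡ suc x → ∃[ y ] x < y × y ≤ M × V y ≡ V x
      size     : ∀ {x} → x ≤ M → OneOrDPlusOne (remaining V (V x) 1 M)

  -- Reading V from position p on, f positions remain.  A frame (ℓ , r) stands for an open block ℓ that will be
  -- resumed now and then r more times, a new block being opened before each of those.  A bit true opens a block of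
  -- size d + 1, false a singleton; a and b count the bits true of the colour of p and of the other colour.
  data Run (V : ℕ → ℕ) : Mode → (p f : ℕ) → List Frame → (a b : ℕ) → List Bool → Set where
    stop  : ∀ {p} → Run V resuming p 0 [] 0 0 []
    cont0 : ∀ {p f ℓ S a b w} → V p ≡ ℓ → Run V resuming (suc p) f S b a w → Run V resuming p (suc f) ((ℓ , 0) ∷ S) a b w
    contS : ∀ {p f ℓ r S a b w} → V p ≡ ℓ → Run V opening (suc p) f ((ℓ , r) ∷ S) b a w →
            Run V resuming p (suc f) ((ℓ , suc r) ∷ S) a b w
    new0  : ∀ {p f S a b w} → V p ≡ p → Run V resuming (suc p) f S b a w → Run V opening p (suc f) S a b (false ∷ w)
    new1  : ∀ {p f S a b w} → V p ≡ p → Run V opening (suc p) f ((p , e) ∷ S) b a w →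
            Run V opening p (suc f) S (suc a) b (true ∷ w)

  -- The machine with labels forgotten: only the counters of the frames steer it. The arguments `a`
  -- and `b` trade places at every step because the colours of the positions alternate.
  words : Mode → ℕ → List ℕ → ℕ → ℕ → List (List Bool)
  words opening zero    S       a       b       = []
  words opening (suc f) S       zero    b       = map (false ∷_) (words resuming f S b 0)
  words opening (suc f) S       (suc a) b       = map (false ∷_) (words resuming f S b (suc a)) ++ map (true ∷_) (words opening f (e ∷ S) b a)
  words resuming zero    []      zero    zero    = [ [] ]
  words resuming zero    []      zero    (suc _) = []
  words resuming zero    []      (suc _) _       = []
  words resuming zero    (_ ∷ _) a       b       = []
  words resuming (suc f) []            a b = []
  words resuming (suc f) (zero  ∷ S)   a b = words resuming f S b a
  words resuming (suc f) (suc r ∷ S)   a b = words opening f (r ∷ S) b a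

  -- The colours of the frames alternate, so these count the blocks of each colour that are still to be opened.
  evens odds : List ℕ → ℕ
  evens []      = 0
  evens (r ∷ S) = r + odds S
  odds []      = 0
  odds (r ∷ S) = evens S

  -- The number of positions the stack still consumes if all blocks to come are singletons: one for
  -- the resumption due, two for each later one. Every bit `true` adds d openings and d resumptions,
  -- whence the term `(d + d) * (a + b)` next to it.
  area : List ℕ → ℕ
  area []      = 0
  area (r ∷ S) = suc (r + r + area S)

  -- The exponents of A and B are the numbers of openings that the present state already owes. A
  -- small choice drops one factor A; a large one trades it for x Bᵈ, since the frame `e` owes d
  -- openings of the other colour, one of them at once.
  count-opening : ∀ f S a b → f ≡ suc (area S + (d + d) * (a + b)) →
            ForestNumber (length (words opening f S a b)) (suc (evens S)) (odds S) a b
  count-resuming : ∀ f S a b → f ≡ area S + (d + d) * (a + b) →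
            ForestNumber (length (words resuming f S a b)) (odds S) (evens S) a b
  count-opening (suc f) S zero b eq =
    forest-leaf (evens S) (odds S) b
      (subst (λ L → ForestNumber L (evens S) (odds S) 0 b) (sym (length-map (false ∷_) (words resuming f S b 0)))
        (forest-swap (odds S) (evens S) b 0 (count-resuming f S b 0
          (trans (suc-injective eq) (cong (λ t → area S + (d + d) * t) (sym (+-identityʳ b)))))))
  count-opening (suc f) S (suc a) b eq =
    subst (λ L → ForestNumber L (suc (evens S)) (odds S) (suc a) b)
      (sym (trans (length-++ (map (false ∷_) (words resuming f S b (suc a))))
        (cong₂ _+_ (length-map (false ∷_) (words resuming f S b (suc a))) (length-map (true ∷_) (words opening f (e ∷ S) b a)))))
      (forest-node (evens S) (odds S) a b
        (forest-swap (odds S) (evens S) b (suc a) (count-resuming f S b (suc a)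
          (trans (suc-injective eq) (cong (λ t → area S + (d + d) * t) (+-comm (suc a) b)))))
        (forest-swap (suc (e + odds S)) (evens S) b a (count-opening f (e ∷ S) b a
          (trans (suc-injective eq) (arith (area S) e a b)))))
    where
    arith : ∀ s e a b → s + (suc e + suc e) * (suc a + b) ≡ suc (suc (e + e + s) + (suc e + suc e) * (b + a))
    arith = solve-∀
  count-resuming zero    []      zero    zero    eq = forest-empty
  -- Large blocks are still due but no frame is left to host them: there is no word, and A⁰ B⁰ has
  -- no such coefficient.
  count-resuming zero    []      zero    (suc b) eq = forest-none 0 (suc b) (s≤s z≤n)
  count-resuming zero    []      (suc a) b       eq = forest-none (suc a) b (s≤s z≤n)
  count-resuming (suc f) []      zero    zero    eq = case trans eq (*-zeroʳ (d + d)) of λ ()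
  count-resuming (suc f) []      zero    (suc b) eq = forest-none 0 (suc b) (s≤s z≤n)
  count-resuming (suc f) []      (suc a) b       eq = forest-none (suc a) b (s≤s z≤n)
  count-resuming (suc f) (zero  ∷ S) a b eq = forest-swap (odds S) (evens S) b a (count-resuming f S b a
    (trans (suc-injective eq) (cong (λ t → area S + (d + d) * t) (+-comm a b))))
  count-resuming (suc f) (suc r ∷ S) a b eq = forest-swap (suc (r + odds S)) (evens S) b a (count-opening f (r ∷ S) b a
    (trans (suc-injective eq) (arith r (area S) (d + d) a b)))
    where
    arith : ∀ r s t a b → suc r + suc r + s + t * (a + b) ≡ suc (suc (r + r + s) + t * (b + a))
    arith = solve-∀

  words-unique : ∀ m f S a b → Unique (words m f S a b)
  words-unique opening zero    S       a       b       = []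
  words-unique opening (suc f) S       zero    b       = Uniq.map⁺ ∷ᴸ-injectiveʳ (words-unique resuming f S b 0)
  words-unique opening (suc f) S       (suc a) b       =
    Uniq.++⁺ (Uniq.map⁺ ∷ᴸ-injectiveʳ (words-unique resuming f S b (suc a)))
             (Uniq.map⁺ ∷ᴸ-injectiveʳ (words-unique opening f (e ∷ S) b a))
             λ { (u , v) → case (∈-map⁻ (false ∷_) u , ∈-map⁻ (true ∷_) v) of
                 λ { ((_ , _ , refl) , (_ , _ , ())) } }
  words-unique resuming zero    []      zero    zero    = [] ∷ []
  words-unique resuming zero    []      zero    (suc _) = []
  words-unique resuming zero    []      (suc _) _       = []
  words-unique resuming zero    (_ ∷ _) a       b       = []
  words-unique resuming (suc f) []            a b = []
  words-unique resuming (suc f) (zero  ∷ S)   a b = words-unique resuming f S b a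
  words-unique resuming (suc f) (suc r ∷ S)   a b = words-unique opening f (r ∷ S) b a

  -- Accepted words are the words of runs

  run⇒∈ : ∀ {V m p f S a b w} → Run V m p f S a b w → w ∈ words m f (map proj₂ S) a b
  run⇒∈ stop = here refl
  run⇒∈ (cont0 _ r) = run⇒∈ r
  run⇒∈ (contS _ r) = run⇒∈ r
  run⇒∈ {a = zero}  (new0 _ r) = ∈-map⁺ (false ∷_) (run⇒∈ r)
  run⇒∈ {a = suc a} (new0 _ r) = ∈-++⁺ˡ (∈-map⁺ (false ∷_) (run⇒∈ r))
  run⇒∈ (new1 {f = f} {S = S} {a = a} {b = b} _ r) =
    ∈-++⁺ʳ (map (false ∷_) (words resuming f (map proj₂ S) b (suc a))) (∈-map⁺ (true ∷_) (run⇒∈ r))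

  agree-head : ∀ {V V′ : ℕ → ℕ} {p f} → (∀ x → p ≤ x → x < p + suc f → V x ≡ V′ x) → V p ≡ V′ p
  agree-head {p = p} h = h p ≤-refl (m<m+n p (s≤s z≤n))

  agree-tail : ∀ {V V′ : ℕ → ℕ} {p f} → (∀ x → p ≤ x → x < p + suc f → V x ≡ V′ x) →
               ∀ x → suc p ≤ x → x < suc p + f → V x ≡ V′ x
  agree-tail {p = p} {f} h x p<x x< = h x (<⇒≤ p<x) (subst (x <_) (sym (+-suc p f)) x<)

  run-cong : ∀ {V V′ m p f S a b w} → (∀ x → p ≤ x → x < p + f → V x ≡ V′ x) →
             Run V m p f S a b w → Run V′ m p f S a b w
  run-cong h stop = stop
  run-cong h (cont0 eq r) = cont0 (trans (sym (agree-head h)) eq) (run-cong (agree-tail h) r)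
  run-cong h (contS eq r) = contS (trans (sym (agree-head h)) eq) (run-cong (agree-tail h) r)
  run-cong h (new0 eq r)  = new0 (trans (sym (agree-head h)) eq) (run-cong (agree-tail h) r)
  run-cong h (new1 eq r)  = new1 (trans (sym (agree-head h)) eq) (run-cong (agree-tail h) r)

  _[_↦_] : (ℕ → ℕ) → ℕ → ℕ → ℕ → ℕ
  (V [ p ↦ z ]) x = if x ≡ᵇ p then z else V x

  update-at : ∀ V p z → (V [ p ↦ z ]) p ≡ z
  update-at V p z rewrite ≡ᵇ-true {p} refl = refl

  update-off : ∀ V {p z x} → p < x → (V [ p ↦ z ]) x ≡ V x
  update-off V {p} {z} {x} p<x rewrite ≡ᵇ-false {x} {p} (λ { refl → <-irrefl refl p<x }) = refl

  run-update : ∀ {V m p f S a b w z} → Run V m (suc p) f S a b w → Run (V [ p ↦ z ]) m (suc p) f S a b w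
  run-update {V} = run-cong λ x p<x _ → sym (update-off V p<x)

  -- The labelling is built from the last position backwards: a run from `suc p` does not look at
  -- `p`, so position `p` can be overwritten afterwards.
  ∈⇒run : ∀ m p f S a b {w} → w ∈ words m f (map proj₂ S) a b → Σ[ V ∈ (ℕ → ℕ) ] Run V m p f S a b w
  ∈⇒run opening p (suc f) S zero b w∈ with ∈-map⁻ (false ∷_) w∈
  ... | w′ , w′∈ , refl with ∈⇒run resuming (suc p) f S b 0 w′∈
  ...   | V , r = V [ p ↦ p ] , new0 (update-at V p p) (run-update r)
  ∈⇒run opening p (suc f) S (suc a) b w∈ with ∈-++⁻ (map (false ∷_) (words resuming f (map proj₂ S) b (suc a))) w∈
  ... | inj₁ w∈₁ with ∈-map⁻ (false ∷_) w∈₁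
  ...   | w′ , w′∈ , refl with ∈⇒run resuming (suc p) f S b (suc a) w′∈
  ...     | V , r = V [ p ↦ p ] , new0 (update-at V p p) (run-update r)
  ∈⇒run opening p (suc f) S (suc a) b w∈ | inj₂ w∈₂ with ∈-map⁻ (true ∷_) w∈₂
  ...   | w′ , w′∈ , refl with ∈⇒run opening (suc p) f ((p , e) ∷ S) b a w′∈
  ...     | V , r = V [ p ↦ p ] , new1 (update-at V p p) (run-update r)
  ∈⇒run resuming p zero [] zero zero (here refl) = (λ _ → 0) , stop
  ∈⇒run resuming p zero [] zero (suc b) ()
  ∈⇒run resuming p zero [] (suc a) b ()
  ∈⇒run resuming p zero (_ ∷ _) a b ()
  ∈⇒run resuming p (suc f) [] a b ()
  ∈⇒run resuming p (suc f) ((ℓ , zero) ∷ S) a b w∈ with ∈⇒run resuming (suc p) f S b a w∈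
  ... | V , r = V [ p ↦ ℓ ] , cont0 (update-at V p ℓ) (run-update r)
  ∈⇒run resuming p (suc f) ((ℓ , suc r) ∷ S) a b w∈ with ∈⇒run opening (suc p) f ((ℓ , r) ∷ S) b a w∈
  ... | V , r = V [ p ↦ ℓ ] , contS (update-at V p ℓ) (run-update r)

  -- The same stack and the same word force the same moves. This makes the passage from labelings to
  -- words injective.
  run-values : ∀ {V V′ m p f S a b a′ b′ w} → Run V m p f S a b w → Run V′ m p f S a′ b′ w →
               ∀ {x} → p ≤ x → x < p + f → V x ≡ V′ x
  run-values {p = p} stop stop p≤x x< = ⊥-elim (<⇒≱ x< (subst (_≤ _) (sym (+-identityʳ p)) p≤x))
  run-values (cont0 v r) (cont0 v′ r′) p≤x x< with m≤n⇒m<n∨m≡n p≤x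
  ... | inj₂ refl = trans v (sym v′)
  ... | inj₁ p<x  = run-values r r′ p<x (shift-< x<)
  run-values (contS v r) (contS v′ r′) p≤x x< with m≤n⇒m<n∨m≡n p≤x
  ... | inj₂ refl = trans v (sym v′)
  ... | inj₁ p<x  = run-values r r′ p<x (shift-< x<)
  run-values (new0 v r) (new0 v′ r′) p≤x x< with m≤n⇒m<n∨m≡n p≤x
  ... | inj₂ refl = trans v (sym v′)
  ... | inj₁ p<x  = run-values r r′ p<x (shift-< x<)
  run-values (new1 v r) (new1 v′ r′) p≤x x< with m≤n⇒m<n∨m≡n p≤x
  ... | inj₂ refl = trans v (sym v′)
  ... | inj₁ p<x  = run-values r r′ p<x (shift-< x<)

-- Every run traces a planar labelling

module Trace (e : ℕ) where
  open Machine e public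

  -- The invariant of the stacks. Alternating colours ensure that a block is only resumed at
  -- positions of its own colour; decreasing labels ensure that no block has two frames.
  data Nested (V : ℕ → ℕ) : ℕ → Bool → List Frame → Set where
    []  : ∀ {q c} → Nested V q c []
    cons : ∀ {q c ℓ r S} → ℓ < q → V ℓ ≡ ℓ → colour ℓ ≡ c → Nested V ℓ (not c) S → Nested V q c ((ℓ , r) ∷ S)

  nested-mono : ∀ {V q q′ c S} → q ≤ q′ → Nested V q c S → Nested V q′ c S
  nested-mono le [] = []
  nested-mono le (cons ℓ< fix pc n) = cons (≤-trans ℓ< le) fix pc n

  topColour : Mode → Bool → Bool
  topColour resuming c = c
  topColour opening c = not c

  nested-cont0 : ∀ {V p ℓ r S} → Nested V p (colour p) ((ℓ , r) ∷ S) → Nested V (suc p) (not (colour p)) S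
  nested-cont0 (cons ℓ< _ _ n) = nested-mono (<⇒≤ (m<n⇒m<1+n ℓ<)) n

  nested-contS : ∀ {V p ℓ r r′ S} → Nested V p (colour p) ((ℓ , r) ∷ S) → Nested V (suc p) (not (not (colour p))) ((ℓ , r′) ∷ S)
  nested-contS {V} {p} {r′ = r′} {S = S} (cons {ℓ = ℓ} ℓ< fix pc n) = subst (λ c → Nested V (suc p) c ((ℓ , r′) ∷ S)) (sym (not-involutive (colour p)))
    (cons (m<n⇒m<1+n ℓ<) fix pc n)

  nested-new1 : ∀ {V p S r} → V p ≡ p → Nested V p (not (colour p)) S → Nested V (suc p) (not (not (colour p))) ((p , r) ∷ S)
  nested-new1 {V} {p} {S} {r} fix n = subst (λ c → Nested V (suc p) c ((p , r) ∷ S)) (sym (not-involutive (colour p)))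
    (cons ≤-refl fix refl n)

  left : ℕ → List Frame → ℕ
  left z []            = 0
  left z ((ℓ , r) ∷ S) = (if ℓ ≡ᵇ z then suc r else 0) + left z S

  left-outside : ∀ {V q c S z} → Nested V q c S → q ≤ z → left z S ≡ 0
  left-outside [] q≤z = refl
  left-outside {z = z} (cons {ℓ = ℓ} ℓ< _ _ n) q≤z
    rewrite ≡ᵇ-false {ℓ} {z} (λ { refl → <⇒≱ ℓ< q≤z }) = left-outside n (<⇒≤ (≤-trans ℓ< q≤z))

  left-hit : ∀ ℓ r S → left ℓ ((ℓ , r) ∷ S) ≡ suc r + left ℓ S
  left-hit ℓ r S rewrite ≡ᵇ-true {ℓ} refl = refl

  left-miss : ∀ {ℓ z} r S → ℓ ≢ z → left z ((ℓ , r) ∷ S) ≡ left z S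
  left-miss r S neq rewrite ≡ᵇ-false neq = refl

  -- A run ends with the empty stack, so each open block recurs exactly as often as its frame
  -- promises and a closed one never does. For `z ≥ p` this would fail, as bits still to be read
  -- decide how often such a block occurs.
  remaining≡left : ∀ {V m p f S a b w z} → Run V m p f S a b w → z < p → remaining V z p f ≡ left z S
  remaining≡left stop z<p = refl
  remaining≡left {z = z} (cont0 {ℓ = ℓ} {S = S} eq r) z<p with ℓ ≟ z
  ... | yes refl rewrite ≡ᵇ-true {ℓ} refl | ≡ᵇ-true eq = cong suc (remaining≡left r (m<n⇒m<1+n z<p))
  ... | no neq rewrite ≡ᵇ-false neq | ≡ᵇ-false (neq ∘ trans (sym eq)) = remaining≡left r (m<n⇒m<1+n z<p)
  remaining≡left {z = z} (contS {ℓ = ℓ} {r = r′} {S = S} eq r) z<p with ℓ ≟ z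
  ... | yes refl rewrite ≡ᵇ-true {ℓ} refl | ≡ᵇ-true eq = cong suc (trans (remaining≡left r (m<n⇒m<1+n z<p)) (left-hit ℓ r′ S))
  ... | no neq rewrite ≡ᵇ-false neq | ≡ᵇ-false (neq ∘ trans (sym eq)) =
    trans (remaining≡left r (m<n⇒m<1+n z<p)) (left-miss r′ S neq)
  remaining≡left {V} (new0 {p = p} {f = f} eq r) z<p = trans (remaining-miss V p f λ q → <⇒≢ z<p (trans (sym q) eq)) (remaining≡left r (m<n⇒m<1+n z<p))
  remaining≡left {V} (new1 {p = p} {f = f} {S = S} eq r) z<p = trans (remaining-miss V p f λ q → <⇒≢ z<p (trans (sym q) eq))
    (trans (remaining≡left r (m<n⇒m<1+n z<p)) (left-miss e S (<⇒≢ z<p ∘ sym)))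

  run-resuming-old : ∀ {V p f S a b w c} → Run V resuming p f S a b w → Nested V p c S → 0 < f → V p < p
  run-resuming-old (cont0 refl _) (cons ℓ< _ _ _) _ = ℓ<
  run-resuming-old (contS refl _) (cons ℓ< _ _ _) _ = ℓ<

  run-opening-new : ∀ {V p f S a b w} → Run V opening p f S a b w → V p ≡ p
  run-opening-new (new0 eq _) = eq
  run-opening-new (new1 eq _) = eq

  -- Planarity seen from one position: every condition on later positions is phrased through
  -- `remaining`, which the stack can answer.
  record Local (V : ℕ → ℕ) (x g : ℕ) : Set where
    field
      le         : V x ≤ x
      idem       : V (V x) ≡ V x
      coloured   : colour (V x) ≡ colour x
      nc         : ∀ {z} → V x < z → z ≤ x → remaining V z (suc x) g ≡ 0
      open⇒new   : remaining V (V x) (suc x) g ≢ 0 → V (suc x) ≡ suc x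
      closed⇒old : remaining V (V x) (suc x) g ≡ 0 → 0 < g → V (suc x) ≢ suc x
      size       : V x ≡ x → OneOrDPlusOne (remaining V x x (suc g))

  -- The common part of the two resuming moves, which differ only in the stack `T` they leave
  -- behind.
  local-old : ∀ {V p f ℓ r S m a b w} → V p ≡ ℓ → Nested V p (colour p) ((ℓ , r) ∷ S) →
    (T : List Frame) → (∀ {z} → ℓ < z → left z T ≡ 0) →
    Run V m (suc p) f T a b w → (left ℓ T ≢ 0 → V (suc p) ≡ suc p) → (left ℓ T ≡ 0 → 0 < f → V (suc p) ≢ suc p) →
    Local V p f
  local-old {V} {p} {f} refl (cons ℓ< fix pc n) T out run on cn = record
    { le = <⇒≤ ℓ< ; idem = fix ; coloured = pc
    ; nc = λ ℓ<z z≤p → trans (remaining≡left run (s≤s z≤p)) (out ℓ<z)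
    ; open⇒new = λ r≢0 → on (r≢0 ∘ trans eq)
    ; closed⇒old = λ r≡0 → cn (trans (sym eq) r≡0)
    ; size = λ q → ⊥-elim (<⇒≢ ℓ< q) }
    where
    eq = remaining≡left run (m<n⇒m<1+n ℓ<)

  run⇒local : ∀ {V m p f S a b w} → Run V m p f S a b w → Nested V p (topColour m (colour p)) S →
              ∀ k {g} → k + suc g ≡ f → Local V (k + p) g
  local-head : ∀ {V m p f S a b w} → Run V m p (suc f) S a b w → Nested V p (topColour m (colour p)) S → Local V p f
  run⇒local run nest zero refl = local-head run nest
  run⇒local stop nest (suc k) ()
  run⇒local {V} {p = p} (cont0 _ run) nest (suc k) {g} eq =
    subst (λ x → Local V x g) (+-suc k p) (run⇒local run (nested-cont0 nest) k (suc-injective eq))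
  run⇒local {V} {p = p} (contS _ run) nest (suc k) {g} eq =
    subst (λ x → Local V x g) (+-suc k p) (run⇒local run (nested-contS nest) k (suc-injective eq))
  run⇒local {V} {p = p} (new0 _ run) nest (suc k) {g} eq =
    subst (λ x → Local V x g) (+-suc k p) (run⇒local run (nested-mono (n≤1+n p) nest) k (suc-injective eq))
  run⇒local {V} {p = p} (new1 eq₁ run) nest (suc k) {g} eq =
    subst (λ x → Local V x g) (+-suc k p) (run⇒local run (nested-new1 eq₁ nest) k (suc-injective eq))
  local-head {V} {p = p} (cont0 {ℓ = ℓ} {S = S} eq run) nest@(cons ℓ< _ _ n) =
    local-old eq nest S (λ ℓ<z → left-outside n (<⇒≤ ℓ<z)) run
      (λ l≢0 → ⊥-elim (l≢0 (left-outside n ≤-refl)))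
      (λ _ 0<f → <⇒≢ (run-resuming-old run (nested-cont0 nest) 0<f))
  local-head {V} {p = p} (contS {ℓ = ℓ} {r = r} {S = S} eq run) nest@(cons ℓ< _ _ n) =
    local-old eq nest ((ℓ , r) ∷ S)
      (λ ℓ<z → trans (left-miss r S (<⇒≢ ℓ<z)) (left-outside n (<⇒≤ ℓ<z))) run
      (λ _ → run-opening-new run)
      (λ l≡0 → case trans (sym (left-hit ℓ r S)) l≡0 of λ ())
  local-head {V} {p = p} (new0 {f = f} {S = S} eq run) nest = record
    { le = ≤-reflexive eq ; idem = cong V eq ; coloured = cong colour eq
    ; nc = λ p<z z≤p → ⊥-elim (<⇒≱ p<z (subst (_ ≤_) (sym eq) z≤p))
    ; open⇒new = λ r≢0 → ⊥-elim (r≢0 (subst (λ z → remaining V z (suc p) f ≡ 0) (sym eq) none))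
    ; closed⇒old = λ _ 0<f → <⇒≢ (run-resuming-old run (nested-mono (n≤1+n p) nest) 0<f)
    ; size = λ _ → inj₁ (trans (remaining-hit V p f eq) (cong suc none)) }
    where
    none : remaining V p (suc p) f ≡ 0
    none = trans (remaining≡left run ≤-refl) (left-outside nest ≤-refl)
  local-head {V} {p = p} (new1 {f = f} {S = S} eq run) nest = record
    { le = ≤-reflexive eq ; idem = cong V eq ; coloured = cong colour eq
    ; nc = λ p<z z≤p → ⊥-elim (<⇒≱ p<z (subst (_ ≤_) (sym eq) z≤p))
    ; open⇒new = λ _ → run-opening-new run
    ; closed⇒old = λ r≡0 → case trans (sym some) (subst (λ z → remaining V z (suc p) f ≡ 0) eq r≡0) of λ ()
    ; size = λ _ → inj₂ (trans (remaining-hit V p f eq) (cong suc some)) }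
    where
    some : remaining V p (suc p) f ≡ d
    some = trans (remaining≡left run ≤-refl) (trans (left-hit p e S) (trans (cong (d +_) (left-outside nest ≤-refl)) (+-identityʳ d)))

  -- The stack after position 0. As position 0 is not counted in the size, a large root block is
  -- resumed d + 1 times, any other large block only d times: hence `t` is `d` here, while `new1`
  -- pushes `e`.
  root : ℕ → List Frame
  root t = (0 , t) ∷ []

  remaining-all : ∀ {V M z} x g → suc x + g ≡ suc M → (∀ y → 1 ≤ y → y ≤ x → V y ≢ z) → remaining V z 1 M ≡ remaining V z (suc x) g
  remaining-all {V} {M} {z} x g eq h = trans (cong (remaining V z 1) (sym (suc-injective eq)))
    (trans (cnt-++ (λ y → V y ≡ᵇ z) 1 x g)
      (cong (_+ remaining V z (suc x) g) (cnt-zero 1 x λ y 1≤y y< → ≡ᵇ-false (h y 1≤y (≤-pred y<)))))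

  module Sound {V M t a b w} (run : Run V opening 1 M (root t) a b w) (V0 : V 0 ≡ 0) (ht : OneOrDPlusOne (suc t)) where

    nest : Nested V 1 false (root t)
    nest = cons (s≤s z≤n) V0 refl []

    local : ∀ {x} g → suc x + g ≡ M → Local V (suc x) g
    local {x} g eq = subst (λ y → Local V y g) (+-comm x 1) (run⇒local run nest x (trans (+-suc x g) eq))

    split : ∀ {x} → x ≤ M → ∃[ g ] x + g ≡ M
    split x≤M = m≤n⇒∃[o]m+o≡n x≤M

    remaining-root : remaining V 0 1 M ≡ suc t
    remaining-root = trans (remaining≡left run (s≤s z≤n)) (cong suc (+-identityʳ t))

    planar : Planar V M
    planar = record
      { le = λ { {zero} _ → ≤-reflexive V0 ; {suc x} x≤M → Local.le (loc x≤M) }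
      ; idem = λ { {zero} _ → cong V V0 ; {suc x} x≤M → Local.idem (loc x≤M) }
      ; coloured = λ { {zero} _ → cong colour V0 ; {suc x} x≤M → Local.coloured (loc x≤M) }
      ; nc = nc
      ; open⇒new = open⇒new
      ; new⇒open = new⇒open
      ; size = size }
      where
      rest : ∀ {x} → x ≤ M → ℕ
      rest x≤M = proj₁ (split x≤M)
      loc : ∀ {x} (x≤M : suc x ≤ M) → Local V (suc x) (rest x≤M)
      loc x≤M = local (rest x≤M) (proj₂ (split x≤M))
      within : ∀ {x y} (x≤M : x ≤ M) → y ≤ M → y < suc x + rest x≤M
      within x≤M y≤M = s≤s (subst (_ ≤_) (sym (proj₂ (split x≤M))) y≤M)
      le′ : ∀ {x} → x ≤ M → V x ≤ x
      le′ {zero} _ = ≤-reflexive V0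
      le′ {suc x} x≤M = Local.le (loc x≤M)
      nc : ∀ {x y} → x < y → y ≤ M → V x < V y → V y ≤ x → ⊥
      nc {zero} {y} x<y y≤M Vx<Vy Vy≤x = <⇒≱ Vx<Vy (≤-trans Vy≤x z≤n)
      nc {suc x} {y} x<y y≤M Vx<Vy Vy≤x =
        cnt-zero⁻ _ _ (Local.nc (loc x≤M) Vx<Vy Vy≤x) x<y (within x≤M y≤M) (≡ᵇ-true {V y} refl)
        where x≤M = <⇒≤ (≤-trans x<y y≤M)
      open⇒new : ∀ {x y} → x < y → y ≤ M → V y ≡ V x → V (suc x) ≡ suc x
      open⇒new {zero} _ _ _ = run-opening-new run
      open⇒new {suc x} x<y y≤M eq = Local.open⇒new (loc x≤M)
        λ r≡0 → cnt-zero⁻ _ _ r≡0 x<y (within x≤M y≤M) (≡ᵇ-true eq)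
        where x≤M = <⇒≤ (≤-trans x<y y≤M)
      later : ∀ {x g c} → x + g ≡ M → remaining V (V x) (suc x) g ≡ suc c → ∃[ y ] x < y × y ≤ M × V y ≡ V x
      later {x} {g} eq r with cnt-pos⁻ (suc x) g r
      ... | y , x<y , y< , Vy = y , x<y , subst (y ≤_) eq (≤-pred y<) , ≡ᵇ-sound Vy
      new⇒open : ∀ {x} → x < M → V (suc x) ≡ suc x → ∃[ y ] x < y × y ≤ M × V y ≡ V x
      new⇒open {zero} _ _ = later {0} refl (trans (cong (λ z → remaining V z 1 M) V0) remaining-root)
      new⇒open {suc x} x<M new with remaining V (V (suc x)) (suc (suc x)) (rest (<⇒≤ x<M)) in eq
      ... | suc c = later (proj₂ (split (<⇒≤ x<M))) eq
      ... | zero  = ⊥-elim (Local.closed⇒old (loc (<⇒≤ x<M)) eq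
                      (+-cancelˡ-< (suc x) 0 _ (subst₂ _<_ (sym (+-identityʳ (suc x))) (sym (proj₂ (split (<⇒≤ x<M)))) x<M)) new)
      size : ∀ {x} → x ≤ M → OneOrDPlusOne (remaining V (V x) 1 M)
      -- The size is read off at the least position of the block: from the root frame if that is 0,
      -- otherwise from the move that opened the block.
      size {x} x≤M = go (V x) refl
        where
        idem′ : ∀ {x} → x ≤ M → V (V x) ≡ V x
        idem′ {zero} _ = cong V V0
        idem′ {suc x} x≤M = Local.idem (loc x≤M)
        go : ∀ z → V x ≡ z → OneOrDPlusOne (remaining V z 1 M)
        go zero eq = subst OneOrDPlusOne (sym remaining-root) ht
        go (suc z) eq = subst OneOrDPlusOne (sym (remaining-all z (suc (rest z≤M)) (trans (+-suc (suc z) _) (cong suc (proj₂ (split z≤M))))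
              λ y 1≤y y≤z Vy≡ → <⇒≱ (s≤s y≤z) (subst (_≤ y) Vy≡ (le′ (≤-trans y≤z (<⇒≤ z≤M))))))
            (Local.size (loc z≤M) (trans (cong V (sym eq)) (trans (idem′ x≤M) eq)))
          where
          z≤M : suc z ≤ M
          z≤M = subst (_≤ M) eq (≤-trans (le′ x≤M) x≤M)

-- Every planar labelling is traced by a run

module Simulation (e : ℕ) where
  open Trace e public

  -- The labelling reveals each bit: after a singleton the next position is old, after the opening
  -- of a large block it is new.
  run-word-unique : ∀ {V m p f S a b w a′ b′ w′} → Run V m p f S a b w → Run V m p f S a′ b′ w′ →
                    Nested V p (topColour m (colour p)) S → w ≡ w′
  run-word-unique stop stop _ = refl
  run-word-unique (cont0 _ r) (cont0 _ r′) n = run-word-unique r r′ (nested-cont0 n)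
  run-word-unique (contS _ r) (contS _ r′) n = run-word-unique r r′ (nested-contS n)
  run-word-unique {p = p} (new0 _ r) (new0 _ r′) n = cong (false ∷_) (run-word-unique r r′ (nested-mono (n≤1+n p) n))
  run-word-unique (new1 v r) (new1 _ r′) n = cong (true ∷_) (run-word-unique r r′ (nested-new1 v n))
  run-word-unique {p = p} {f = suc (suc f)} (new0 _ r) (new1 _ r′) n =
    ⊥-elim (<-irrefl (run-opening-new r′) (run-resuming-old r (nested-mono (n≤1+n p) n) (s≤s z≤n)))
  run-word-unique {p = p} {f = suc (suc f)} (new1 _ r) (new0 _ r′) n =
    ⊥-elim (<-irrefl (run-opening-new r) (run-resuming-old r′ (nested-mono (n≤1+n p) n) (s≤s z≤n)))

  -- Positions that do not open a block, of the colour of p (old) and of the other colour (skip).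
  old skip : (ℕ → ℕ) → ℕ → ℕ → ℕ
  old V p zero     = 0
  old V p (suc f)  = bit (not (V p ≡ᵇ p)) + skip V (suc p) f
  skip V p zero    = 0
  skip V p (suc f) = old V (suc p) f

  pending pending′ : List Frame → ℕ
  pending []             = 0
  pending ((_ , r) ∷ S)  = suc r + pending′ S
  pending′ []            = 0
  pending′ (_ ∷ S)       = pending S

  OldCount : Mode → (V : ℕ → ℕ) → (p f : ℕ) → List Frame → (a b : ℕ) → Set
  OldCount resuming V p f S a b = old V p f ≡ pending S + d * a × skip V p f ≡ pending′ S + d * b
  OldCount opening V p f S a b = old V p f ≡ pending′ S + d * a × skip V p f ≡ pending S + d * b

  -- A position that opens no block is a resumption, either promised by the stack or one of the d
  -- that a large block brings. This links the rank to the number of large black blocks.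
  run-old : ∀ {V m p f S a b w} → Run V m p f S a b w → Nested V p (topColour m (colour p)) S → OldCount m V p f S a b
  run-old stop _ = sym (*-zeroʳ d) , sym (*-zeroʳ d)
  run-old {V} {p = p} (cont0 v r) n@(cons ℓ< _ _ _) with run-old r (nested-cont0 n)
  ... | o , s rewrite ≡ᵇ-false {V p} {p} (<⇒≢ (subst (_< p) (sym v) ℓ<)) = cong suc s , o
  run-old {V} {p = p} (contS v r) n@(cons ℓ< _ _ _) with run-old r (nested-contS n)
  ... | o , s rewrite ≡ᵇ-false {V p} {p} (<⇒≢ (subst (_< p) (sym v) ℓ<)) = cong suc s , o
  run-old {V} {p = p} (new0 v r) n with run-old r (nested-mono (n≤1+n p) n)
  ... | o , s rewrite ≡ᵇ-true v = s , o
  run-old {V} {p = p} (new1 {S = S} {a = a} v r) n with run-old r (nested-new1 v n)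
  ... | o , s rewrite ≡ᵇ-true v = trans s (arith e (pending′ S) a) , o
    where
    arith : ∀ e q a → suc e + q + suc e * a ≡ q + suc e * suc a
    arith = solve-∀

  frames-area : List Frame → ℕ
  frames-area S = area (map proj₂ S)

  RunLength : Mode → ℕ → List Frame → (a b : ℕ) → Set
  RunLength resuming f S a b = f ≡ frames-area S + (d + d) * (a + b)
  RunLength opening f S a b = f ≡ suc (frames-area S + (d + d) * (a + b))

  run-length : ∀ {V m p f S a b w} → Run V m p f S a b w → RunLength m f S a b
  run-length stop = sym (*-zeroʳ (d + d))
  run-length (cont0 {S = S} {a} {b} _ r) = cong suc (trans (run-length r) (cong (λ t → frames-area S + (d + d) * t) (+-comm b a)))
  run-length (contS {r = r′} {S = S} {a} {b} _ r) = trans (cong suc (run-length r)) (arith r′ (frames-area S) (d + d) a b)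
    where
    arith : ∀ r s t a b → suc (suc (suc (r + r + s) + t * (b + a))) ≡ suc (suc r + suc r + s + t * (a + b))
    arith = solve-∀
  run-length (new0 {S = S} {a} {b} _ r) = cong suc (trans (run-length r) (cong (λ t → frames-area S + (d + d) * t) (+-comm b a)))
  run-length (new1 {S = S} {a} {b} _ r) = cong suc (trans (run-length r) (arith (frames-area S) e a b))
    where
    arith : ∀ s e a b → suc (suc (e + e + s) + (suc e + suc e) * (b + a)) ≡ s + (suc e + suc e) * (suc a + b)
    arith = solve-∀

  -- The second argument is the number of occurrences ahead. The next of them is implicit in a
  -- frame, which explains the shift by one; a block with none ahead is closed and has no frame.
  push : ℕ → ℕ → List Frame → List Frame
  push b zero    S = S
  push b (suc r) S = (b , r) ∷ S

  -- The stack that a run must have reached at p, read off from V when b = p.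
  openFrames : (ℕ → ℕ) → ℕ → ℕ → ℕ → List Frame
  openFrames V f p zero    = []
  openFrames V f p (suc b) = push b (remaining V b p f) (openFrames V f p b)

  openFrames-cong : ∀ {V f p f′ p′} b → (∀ {z} → z < b → remaining V z p f ≡ remaining V z p′ f′) →
                    openFrames V f p b ≡ openFrames V f′ p′ b
  openFrames-cong zero    h = refl
  openFrames-cong (suc b) h = cong₂ (push b) (h ≤-refl) (openFrames-cong b (h ∘ m<n⇒m<1+n))

  openFrames-drop : ∀ {V f p} ℓ k → (∀ {z} → ℓ ≤ z → z < k + ℓ → remaining V z p f ≡ 0) →
                    openFrames V f p (k + ℓ) ≡ openFrames V f p ℓ
  openFrames-drop ℓ zero    h = refl
  openFrames-drop ℓ (suc k) h rewrite h (m≤n+m ℓ k) ≤-refl = openFrames-drop ℓ k λ ℓ≤z z< → h ℓ≤z (m<n⇒m<1+n z<)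

  openFrames-drop′ : ∀ {V f p ℓ q} → ℓ ≤ q → (∀ {z} → ℓ ≤ z → z < q → remaining V z p f ≡ 0) →
                     openFrames V f p q ≡ openFrames V f p ℓ
  openFrames-drop′ {V} {f} {p} {ℓ} ℓ≤q h with m≤n⇒∃[o]m+o≡n ℓ≤q
  ... | k , refl = trans (cong (openFrames V f p) (+-comm ℓ k))
        (openFrames-drop ℓ k λ {z} ℓ≤z z< → h ℓ≤z (subst (z <_) (+-comm k ℓ) z<))

  openFrames-top : ∀ {V f p ℓ q r} → ℓ < q → remaining V ℓ p f ≡ suc r → (∀ {z} → ℓ < z → z < q → remaining V z p f ≡ 0) →
                   openFrames V f p q ≡ (ℓ , r) ∷ openFrames V f p ℓ
  openFrames-top {V} {f} {p} {ℓ} ℓ<q eq h = trans (openFrames-drop′ ℓ<q h) (cong (λ t → push ℓ t (openFrames V f p ℓ)) eq)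

  module Complete {V M} (planar : Planar V M) where
    open Planar planar

    Runs : Mode → (p f : ℕ) → List Frame → Set
    Runs m p f S = ∃[ a ] ∃[ b ] ∃[ w ] Run V m p f S a b w

    remaining-new : ∀ {p f} → 1 ≤ p → V p ≡ p → p + suc f ≡ suc M → remaining V p 1 M ≡ suc (remaining V p (suc p) f)
    remaining-new {suc q} {f} _ fix eq = trans
      (remaining-all q (suc f) eq λ y _ y≤q Vy → <⇒≱ (s≤s y≤q) (subst (_≤ y) Vy (le (≤-trans y≤q q≤M))))
      (remaining-hit V (suc q) f fix)
      where
      q≤M : q ≤ M
      q≤M = ≤-trans (m≤m+n q (suc f)) (≤-reflexive (suc-injective eq))

    -- The stack is kept equal to `openFrames`. Whether `suc p` is new depends only on whether the
    -- block of `p` occurs again, so the mode after each move is the one the machine demands. The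
    -- guards `0 < f` let the run end in resuming mode only.
    simulate : ∀ f p → p + f ≡ suc M → 1 ≤ p →
      ((0 < f → V p ≢ p) → Runs resuming p f (openFrames V f p p)) ×
      (0 < f → V p ≡ p → Runs opening p f (openFrames V f p p))
    simulate zero p eq 1≤p = (λ _ → 0 , 0 , [] , subst (λ S → Run V resuming p 0 S 0 0 []) (sym (openFrames-drop′ {V} {0} {p} {0} {p} z≤n λ _ _ → refl)) stop) , λ ()
    simulate (suc f) p eq 1≤p = simC , simN
      where
      eq′ : suc p + f ≡ suc M
      eq′ = trans (sym (+-suc p f)) eq
      p≤M : p ≤ M
      p≤M = ≤-pred (m+n≤o⇒m≤o (suc p) (≤-reflexive eq′))
      p<M : 0 < f → p < M
      p<M 0<f = subst (p <_) (suc-injective eq′) (m<m+n p 0<f)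
      next = simulate f (suc p) eq′ (s≤s z≤n)
      gone : ∀ {z} → (∀ {y} → p < y → y ≤ M → V y ≢ z) → remaining V z (suc p) f ≡ 0
      gone h = cnt-zero (suc p) f λ y p<y y< → ≡ᵇ-false (h p<y (≤-pred (subst (y <_) eq′ y<)))
      later : ∀ {z c} → remaining V z (suc p) f ≡ suc c → ∃[ y ] p < y × y ≤ M × V y ≡ z
      later r with cnt-pos⁻ (suc p) f r
      ... | y , p<y , y< , Vy = y , p<y , ≤-pred (subst (y <_) eq′ y<) , ≡ᵇ-sound Vy
      new-next : ∀ {c} → remaining V (V p) (suc p) f ≡ suc c → 0 < f × V (suc p) ≡ suc p
      new-next r with later r
      ... | y , p<y , y≤M , Vy = +-cancelˡ-< (suc p) 0 f
              (subst₂ _<_ (sym (+-identityʳ (suc p))) (sym eq′) (s≤s (≤-trans p<y y≤M))) , open⇒new p<y y≤M Vy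
      old-next : remaining V (V p) (suc p) f ≡ 0 → 0 < f → V (suc p) ≢ suc p
      old-next r 0<f new with new⇒open (p<M 0<f) new
      ... | y , p<y , y≤M , Vy = cnt-zero⁻ (suc p) f r p<y (subst (y <_) (sym eq′) (s≤s y≤M)) (≡ᵇ-true Vy)
      nothing-between : ∀ {z} → V p < z → z ≤ p → remaining V z (suc p) f ≡ 0
      nothing-between ℓ<z z≤p = gone λ p<y y≤M Vy → nc p<y y≤M (subst (V p <_) (sym Vy) ℓ<z) (subst (_≤ p) (sym Vy) z≤p)
      unaffected : ∀ {q} → q ≤ V p → openFrames V (suc f) p q ≡ openFrames V f (suc p) q
      unaffected q≤ = openFrames-cong _ λ z<q → remaining-miss V p f λ Vp≡z → <⇒≢ (≤-trans z<q q≤) (sym Vp≡z)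

      simC : (0 < suc f → V p ≢ p) → Runs resuming p (suc f) (openFrames V (suc f) p p)
      simC old with remaining V (V p) (suc p) f in r
      ... | zero = let a , b , w , run = proj₁ next (old-next r) in b , a , w ,
            subst (λ S → Run V resuming p (suc f) S b a w) (sym now)
              (cont0 refl (subst (λ S → Run V resuming (suc p) f S a b w) after run))
        where
        ℓ<p : V p < p
        ℓ<p = ≤∧≢⇒< (le p≤M) (old (s≤s z≤n))
        now : openFrames V (suc f) p p ≡ (V p , 0) ∷ openFrames V f (suc p) (V p)
        now = trans (openFrames-top ℓ<p (trans (remaining-hit V p f refl) (cong suc r))
                λ ℓ<z z<p → trans (remaining-miss V p f (<⇒≢ ℓ<z)) (nothing-between ℓ<z (<⇒≤ z<p)))
              (cong ((V p , 0) ∷_) (unaffected ≤-refl))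
        after : openFrames V f (suc p) (suc p) ≡ openFrames V f (suc p) (V p)
        after = openFrames-drop′ (m≤n⇒m≤1+n (<⇒≤ ℓ<p)) λ {z} ℓ≤z z≤p → case m≤n⇒m<n∨m≡n ℓ≤z of
          λ { (inj₁ ℓ<z) → nothing-between ℓ<z (≤-pred z≤p) ; (inj₂ refl) → r }
      ... | suc c = let 0<f , new = new-next r ; a , b , w , run = proj₂ next 0<f new in b , a , w ,
            subst (λ S → Run V resuming p (suc f) S b a w) (sym now)
              (contS refl (subst (λ S → Run V opening (suc p) f S a b w) after run))
        where
        ℓ<p : V p < p
        ℓ<p = ≤∧≢⇒< (le p≤M) (old (s≤s z≤n))
        now : openFrames V (suc f) p p ≡ (V p , suc c) ∷ openFrames V f (suc p) (V p)
        now = trans (openFrames-top ℓ<p (trans (remaining-hit V p f refl) (cong suc r))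
                λ ℓ<z z<p → trans (remaining-miss V p f (<⇒≢ ℓ<z)) (nothing-between ℓ<z (<⇒≤ z<p)))
              (cong ((V p , suc c) ∷_) (unaffected ≤-refl))
        after : openFrames V f (suc p) (suc p) ≡ (V p , c) ∷ openFrames V f (suc p) (V p)
        after = openFrames-top (m<n⇒m<1+n ℓ<p) r λ ℓ<z z≤p → nothing-between ℓ<z (≤-pred z≤p)

      simN : 0 < suc f → V p ≡ p → Runs opening p (suc f) (openFrames V (suc f) p p)
      simN _ fix = go (remaining V p (suc p) f) refl
        where
        total : remaining V (V p) 1 M ≡ suc (remaining V p (suc p) f)
        total = trans (cong (λ z → remaining V z 1 M) fix) (remaining-new 1≤p fix eq)
        -- The size condition enters here: a block that occurs again is large, so d occurrences are
        -- ahead and its frame is `(p , e)`.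
        small : ∀ {c} → remaining V p (suc p) f ≡ suc c → suc c ≡ d
        small r with size p≤M
        ... | inj₁ s = case trans (sym s) (trans total (cong suc r)) of λ ()
        ... | inj₂ s = suc-injective (sym (trans (sym s) (trans total (cong suc r))))
        go : ∀ c → remaining V p (suc p) f ≡ c → Runs opening p (suc f) (openFrames V (suc f) p p)
        go zero r = let a , b , w , run = proj₁ next (old-next (subst (λ z → remaining V z (suc p) f ≡ 0) (sym fix) r)) in b , a , false ∷ w ,
          new0 fix (subst (λ S → Run V resuming (suc p) f S a b w)
            (trans (cong (λ t → push p t (openFrames V f (suc p) p)) r) (sym (unaffected (≤-reflexive (sym fix))))) run)
        go (suc c) r = let 0<f , new = new-next (subst (λ z → remaining V z (suc p) f ≡ suc c) (sym fix) r) ; a , b , w , run = proj₂ next 0<f new in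
          suc b , a , true ∷ w ,
          new1 fix (subst (λ S → Run V opening (suc p) f S a b w)
            (trans (cong (λ t → push p t (openFrames V f (suc p) p)) (trans r (small r)))
              (cong ((p , e) ∷_) (sym (unaffected (≤-reflexive (sym fix)))))) run)

    V0 : V 0 ≡ 0
    V0 = n≤0⇒n≡0 (le z≤n)

    complete : 0 < M → ∃[ t ] (t ≡ 0 ⊎ t ≡ d) × Runs opening 1 M (root t)
    complete 0<M = go (remaining V 0 1 M) refl
      where
      size₀ : OneOrDPlusOne (remaining V 0 1 M)
      size₀ = subst (λ z → OneOrDPlusOne (remaining V z 1 M)) V0 (size z≤n)
      go : ∀ c → remaining V 0 1 M ≡ c → ∃[ t ] (t ≡ 0 ⊎ t ≡ d) × Runs opening 1 M (root t)
      go zero r with size₀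
      ... | inj₁ s = case trans (sym s) r of λ ()
      ... | inj₂ s = case trans (sym s) r of λ ()
      go (suc t) r = t , ht , subst (Runs opening 1 M) (cong (λ c → push 0 c []) r) (proj₂ (simulate M 1 refl (s≤s z≤n)) 0<M V1)
        where
        ht : t ≡ 0 ⊎ t ≡ d
        ht with size₀
        ... | inj₁ s = inj₁ (suc-injective (trans (sym r) s))
        ... | inj₂ s = inj₂ (suc-injective (trans (sym r) s))
        V1 : V 1 ≡ 1
        V1 with cnt-pos⁻ 1 M r
        ... | y , 0<y , y< , Vy = open⇒new 0<y (≤-pred y<) (trans (≡ᵇ-sound Vy) (sym V0))

-- Even and odd positions

dbl : ℕ → ℕ
dbl zero    = 0
dbl (suc n) = suc (suc (dbl n))

dbl-mono-≤ : ∀ {x y} → x ≤ y → dbl x ≤ dbl y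
dbl-mono-≤ z≤n       = z≤n
dbl-mono-≤ (s≤s x≤y) = s≤s (s≤s (dbl-mono-≤ x≤y))

dbl-mono-< : ∀ {x y} → x < y → suc (dbl x) < dbl y
dbl-mono-< = dbl-mono-≤

dbl-cancel-≤ : ∀ {x y} → dbl x ≤ suc (dbl y) → x ≤ y
dbl-cancel-≤ {zero}          _               = z≤n
dbl-cancel-≤ {suc x} {suc y} (s≤s (s≤s x≤y)) = s≤s (dbl-cancel-≤ x≤y)
dbl-cancel-≤ {suc x} {zero}  (s≤s ())

dbl-cancel-< : ∀ {x y} → dbl x < dbl y → x < y
dbl-cancel-< {zero}  {suc y} _               = s≤s z≤n
dbl-cancel-< {suc x} {suc y} (s≤s (s≤s x<y)) = s≤s (dbl-cancel-< x<y)

dbl-injective : ∀ {x y} → dbl x ≡ dbl y → x ≡ y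
dbl-injective eq = ≤-antisym (dbl-cancel-≤ (m≤n⇒m≤1+n (≤-reflexive eq))) (dbl-cancel-≤ (m≤n⇒m≤1+n (≤-reflexive (sym eq))))

colour-dbl : ∀ x → colour (dbl x) ≡ false
colour-dbl zero    = refl
colour-dbl (suc x) = trans (not-involutive (colour (dbl x))) (colour-dbl x)

dbl≢suc-dbl : ∀ {x y} → dbl x ≢ suc (dbl y)
dbl≢suc-dbl {x} {y} eq = case trans (sym (colour-dbl x)) (trans (cong colour eq) (cong not (colour-dbl y))) of λ ()

data Half : ℕ → Set where
  even : ∀ x → Half (dbl x)
  odd  : ∀ x → Half (suc (dbl x))

half : ∀ p → Half p
half zero = even 0
half (suc p) with half p
... | even x = odd x
... | odd x  = even (suc x)

even-half : ∀ {p} → colour p ≡ false → ∃[ x ] p ≡ dbl x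
even-half {p} eq with half p
... | even x = x , refl
... | odd x  = case trans (sym eq) (cong not (colour-dbl x)) of λ ()

odd-half : ∀ {p} → colour p ≡ true → ∃[ x ] p ≡ suc (dbl x)
odd-half {p} eq with half p
... | odd x  = x , refl
... | even x = case trans (sym eq) (colour-dbl x) of λ ()

cnt-split : ∀ P x f → cnt P (suc (dbl x)) (dbl f) ≡ cnt (P ∘ suc ∘ dbl) x f + cnt (P ∘ dbl) (suc x) f
cnt-split P x zero    = refl
cnt-split P x (suc f) = trans (cong (λ t → bit (P (suc (dbl x))) + (bit (P (suc (suc (dbl x)))) + t)) (cnt-split P (suc x) f))
  (arith (bit (P (suc (dbl x)))) (bit (P (suc (suc (dbl x))))) (cnt (P ∘ suc ∘ dbl) (suc x) f) _)
  where
  arith : ∀ a b c d → a + (b + (c + d)) ≡ (a + c) + (b + d)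
  arith = solve-∀

interleave : (ℕ → ℕ) → (ℕ → ℕ) → ℕ → ℕ
interleave f g zero          = f 0
interleave f g (suc zero)    = g 0
interleave f g (suc (suc p)) = interleave (f ∘ suc) (g ∘ suc) p

interleave-even : ∀ f g x → interleave f g (dbl x) ≡ f x
interleave-even f g zero    = refl
interleave-even f g (suc x) = interleave-even (f ∘ suc) (g ∘ suc) x

interleave-odd : ∀ f g x → interleave f g (suc (dbl x)) ≡ g x
interleave-odd f g zero    = refl
interleave-odd f g (suc x) = interleave-odd (f ∘ suc) (g ∘ suc) x

-- Least representatives and the Kreweras relation on gaps

least : {P : ℕ → Set} → Decidable P → ℕ → ℕ
least P? zero    = 0
least P? (suc x) = if does (P? 0) then 0 else suc (least (P? ∘ suc) x)

least-≤ : ∀ {P : ℕ → Set} (P? : Decidable P) x → least P? x ≤ x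
least-≤ P? zero = z≤n
least-≤ P? (suc x) with P? 0
... | yes _ = z≤n
... | no _  = s≤s (least-≤ (P? ∘ suc) x)

least-holds : ∀ {P : ℕ → Set} (P? : Decidable P) x → P x → P (least P? x)
least-holds P? zero    Px = Px
least-holds P? (suc x) Px with P? 0
... | yes P0 = P0
... | no _   = least-holds (P? ∘ suc) x Px

least-minimal : ∀ {P : ℕ → Set} (P? : Decidable P) x {y} → P y → least P? x ≤ y
least-minimal P? zero    Py = z≤n
least-minimal P? (suc x) {y} Py with P? 0
... | yes _ = z≤n
least-minimal P? (suc x) {zero}  Py | no ¬P0 = ⊥-elim (¬P0 Py)
least-minimal P? (suc x) {suc y} Py | no ¬P0 = s≤s (least-minimal (P? ∘ suc) x Py)

module Class {R : ℕ → ℕ → Set} (R? : ∀ x y → Dec (R x y)) (R-refl : ∀ x → R x x)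
             (R-sym : ∀ x y → R x y → R y x) (R-trans : ∀ x y z → R x y → R y z → R x z) where

  label : ℕ → ℕ
  label x = least (λ y → R? y x) x

  label-≤ : ∀ x → label x ≤ x
  label-≤ x = least-≤ (λ y → R? y x) x

  label-related : ∀ x → R (label x) x
  label-related x = least-holds (λ y → R? y x) x (R-refl x)

  label-minimal : ∀ {x y} → R y x → label x ≤ y
  label-minimal {x} = least-minimal (λ y → R? y x) x

  label-cong : ∀ {x y} → R x y → label x ≡ label y
  label-cong {x} {y} r = ≤-antisym (label-minimal (R-trans _ y x (label-related y) (R-sym x y r)))
                                   (label-minimal (R-trans _ x y (label-related x) r))

  label-reflects : ∀ {x y} → label x ≡ label y → R x y
  label-reflects {x} {y} eq = R-trans x _ y (R-sym _ x (label-related x)) (subst (λ u → R u y) (sym eq) (label-related y))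

-- The arc from z to the minimum b z of its block passes over the gap x, which lies just before the point x.
Cov : (ℕ → ℕ) → ℕ → ℕ → Set
Cov b z x = b z < x × x ≤ z

-- The Kreweras relation on the gaps 0 … n: gaps are equivalent if no block separates them.
K : (ℕ → ℕ) → ℕ → ℕ → ℕ → Set
K b n x y = ∀ {z} → z < n → (Cov b z x → Cov b z y) × (Cov b z y → Cov b z x)

K-refl : ∀ {b n x} → K b n x x
K-refl _ = (λ c → c) , (λ c → c)

K-sym : ∀ {b n x y} → K b n x y → K b n y x
K-sym k z<n = proj₂ (k z<n) , proj₁ (k z<n)

K-trans : ∀ {b n x y z} → K b n x y → K b n y z → K b n x z
K-trans k l z<n = proj₁ (l z<n) ∘ proj₁ (k z<n) , proj₂ (k z<n) ∘ proj₂ (l z<n)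

-- No arc passes over the first or the last gap; this is why n′ may be listed at both ends.
K-ends : ∀ {b n} → K b n 0 n
K-ends z<n = (λ { (() , _) }) , λ { (_ , n≤z) → ⊥-elim (<⇒≱ z<n n≤z) }

-- An arc covers an interval of gaps. One over u is over x as well, hence over w between them; one
-- over w is over y as well, hence over x between them, hence over u.
K-noncrossing : ∀ {b n u w x y} → u < w → w ≤ x → x < y → K b n u x → K b n w y → K b n u w
K-noncrossing u<w w≤x x<y kux kwy z<n =
  (λ cu → <-trans (proj₁ cu) u<w , ≤-trans w≤x (proj₂ (proj₁ (kux z<n) cu))) ,
  (λ cw → proj₂ (kux z<n) (≤-trans (proj₁ cw) w≤x , <⇒≤ (≤-trans x<y (proj₂ (proj₁ (kwy z<n) cw)))))

Cov? : ∀ b z x → Dec (Cov b z x)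
Cov? b z x = (b z <? x) ×-dec (x ≤? z)

K? : ∀ b n x y → Dec (K b n x y)
K? b n x y = allUpTo? (λ z → (Cov? b z x →-dec Cov? b z y) ×-dec (Cov? b z y →-dec Cov? b z x)) n

-- Any crossing of two blocks yields one formed by two elements and the minima of their blocks, so
-- `nc` forbids only these.
record Noncrossing (b : ℕ → ℕ) (n : ℕ) : Set where
  field
    le   : ∀ {z} → z < n → b z ≤ z
    idem : ∀ {z} → z < n → b (b z) ≡ b z
    nc   : ∀ {x y} → x < y → y < n → b x < b y → b y ≤ x → ⊥

module _ {b n} (noncrossing : Noncrossing b n) where
  open Noncrossing noncrossing

  last-in-block : ∀ {x} → x < n → ∃[ m ] x ≤ m × m < n × b m ≡ b x × (∀ {y} → m < y → y < n → b y ≢ b x)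
  last-in-block {x} = go n x (m≤m+n n x)
    where
    go : ∀ k x → n ≤ k + x → x < n → ∃[ m ] x ≤ m × m < n × b m ≡ b x × (∀ {y} → m < y → y < n → b y ≢ b x)
    go zero    x n≤ x<n = ⊥-elim (<⇒≱ x<n n≤)
    go (suc k) x n≤ x<n with anyUpTo? (λ y → (x <? y) ×-dec (b y ≟ b x)) n
    ... | no none = x , ≤-refl , x<n , refl , λ {y} x<y y<n eq → none (y , y<n , x<y , eq)
    ... | yes (y , y<n , x<y , eq) with go k y (≤-trans n≤ (subst (_≤ k + y) (+-suc k x) (+-monoʳ-≤ k x<y))) y<n
    ...   | m , y≤m , m<n , eq′ , l = m , ≤-trans (<⇒≤ x<y) y≤m , m<n , trans eq′ eq , λ m<z z<n q → l m<z z<n (trans q (sym eq))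

  -- The arcs of the block itself pass over neither of these two gaps, and any other arc over just
  -- one of them would cross the block.
  K-around-block : ∀ {x} → x < n → (∀ {y} → x < y → y < n → b y ≢ b x) → K b n (b x) (suc x)
  K-around-block {x} x<n lst {z} z<n = to , from
    where
    to : Cov b z (b x) → Cov b z (suc x)
    to (bz<bx , bx≤z) = s≤s (<⇒≤ (≤-trans bz<bx (le x<n))) , x<z
      where
      x<z : x < z
      x<z with <-cmp z x
      ... | tri< z<x _ _ = ⊥-elim (nc z<x x<n bz<bx bx≤z)
      ... | tri≈ _ refl _ = ⊥-elim (<-irrefl refl bz<bx)
      ... | tri> _ _ x<z = x<z
    from : Cov b z (suc x) → Cov b z (b x)
    from (bz≤x , x<z) = bz<bx , ≤-trans (le x<n) (<⇒≤ x<z)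
      where
      bz<bx : b z < b x
      bz<bx with <-cmp (b z) (b x)
      ... | tri< lt _ _ = lt
      ... | tri≈ _ eq _ = ⊥-elim (lst x<z z<n eq)
      ... | tri> _ _ gt = ⊥-elim (nc x<z z<n gt (≤-pred bz≤x))

  private module GapClass = Class (K? b n) (λ x → K-refl {b} {n} {x}) (λ x y → K-sym {b} {n} {x} {y})
                                  (λ x y z → K-trans {b} {n} {x} {y} {z})
  open GapClass public renaming
    (label to gapLabel; label-≤ to gapLabel-≤; label-related to gapLabel-K; label-minimal to gapLabel-minimal;
     label-cong to gapLabel-cong; label-reflects to gapLabel-reflects)

-- Balanced partitions and planar labellings determine each other

module Weighted (e : ℕ) where
  open Machine e

  blackSize whiteSize : (ℕ → ℕ) → ℕ → ℕ → ℕ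
  blackSize b n x = cnt (λ y → b y ≡ᵇ b x) 0 n
  whiteSize b n x = cnt (λ y → does (K? b n x y)) 1 n

  record Balanced (b : ℕ → ℕ) (n : ℕ) : Set where
    field
      noncrossing : Noncrossing b n
      black : ∀ {x} → x < n → OneOrDPlusOne (blackSize b n x)
      white : ∀ {x} → x < n → OneOrDPlusOne (whiteSize b n (suc x))

  -- Point x (counted from 0) sits at position 2x + 1 and gap x at position 2x.  The primed point i′ of the
  -- Kreweras dual is the gap i + 1, and gap 0 is a second copy of gap n.
  Extends : (ℕ → ℕ) → (ℕ → ℕ) → ℕ → Set
  Extends V b n = ∀ {x} → x < n → V (suc (dbl x)) ≡ suc (dbl (b x))

  does-cong : ∀ {P Q : Set} (P? : Dec P) (Q? : Dec Q) → (P → Q) → (Q → P) → does P? ≡ does Q?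
  does-cong (yes p) Q? to from = sym (dec-true Q? (to p))
  does-cong (no ¬p) Q? to from = sym (dec-false Q? (¬p ∘ from))

  remaining-black : ∀ {V n} β → (∀ {y} → y < n → ∃[ u ] V (dbl (suc y)) ≡ dbl u) →
              remaining V (suc (dbl β)) 1 (dbl n) ≡ cnt (λ y → V (suc (dbl y)) ≡ᵇ suc (dbl β)) 0 n
  remaining-black {V} {n} β ev = trans (cnt-split _ 0 n) (trans (cong (cnt (λ y → V (suc (dbl y)) ≡ᵇ suc (dbl β)) 0 n +_)
    (cnt-zero 1 n λ { (suc y) _ y< → let u , eq = ev (≤-pred y<) in ≡ᵇ-false λ q → dbl≢suc-dbl {u} {β} (trans (sym eq) q) }))
    (+-identityʳ _))

  remaining-white : ∀ {V b n} u → Extends V b n →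
              remaining V (dbl u) 1 (dbl n) ≡ cnt (λ y → V (dbl y) ≡ᵇ dbl u) 1 n
  remaining-white {V} {b} {n} u ext = trans (cnt-split _ 0 n) (cong (_+ cnt (λ y → V (dbl y) ≡ᵇ dbl u) 1 n)
    (cnt-zero 0 n λ y _ y< → ≡ᵇ-false λ q → dbl≢suc-dbl {u} {b y} (trans (sym q) (ext y<))))

  black-size : ∀ {V b n} → Extends V b n → ∀ {x} → x < n → cnt (λ y → V (suc (dbl y)) ≡ᵇ suc (dbl (b x))) 0 n ≡ blackSize b n x
  black-size {V} {b} {n} ext {x} x<n = cnt-cong 0 n λ y _ y<n → does-cong (_ ≟ _) (_ ≟ _)
    (λ q → dbl-injective (suc-injective (trans (sym (ext y<n)) q)))
    (λ q → trans (ext y<n) (cong (suc ∘ dbl) q))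

  module Extend {b n} (bal : Balanced b n) (0<n : 0 < n) where
    open Balanced bal
    open Noncrossing noncrossing

    W : ℕ → ℕ
    W = gapLabel noncrossing

    V : ℕ → ℕ
    V = interleave (dbl ∘ W) (suc ∘ dbl ∘ b)

    V-even : ∀ x → V (dbl x) ≡ dbl (W x)
    V-even = interleave-even _ _

    V-odd : ∀ x → V (suc (dbl x)) ≡ suc (dbl (b x))
    V-odd = interleave-odd _ _

    black< : ∀ {x} → suc (dbl x) ≤ dbl n → x < n
    black< = dbl-cancel-<

    white≤ : ∀ {x} → dbl x ≤ dbl n → x ≤ n
    white≤ = dbl-cancel-≤ ∘ m≤n⇒m≤1+n

    V-le : ∀ {x} → x ≤ dbl n → V x ≤ x
    V-le {x} x≤ with half x
    ... | even y = subst (_≤ dbl y) (sym (V-even y)) (dbl-mono-≤ (gapLabel-≤ noncrossing y))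
    ... | odd y  = subst (_≤ suc (dbl y)) (sym (V-odd y)) (s≤s (dbl-mono-≤ (le (black< x≤))))

    V-idem : ∀ {x} → x ≤ dbl n → V (V x) ≡ V x
    V-idem {x} x≤ with half x
    ... | even y = trans (cong V (V-even y)) (trans (V-even (W y))
                     (trans (cong dbl (gapLabel-cong noncrossing (gapLabel-K noncrossing y))) (sym (V-even y))))
    ... | odd y  = trans (cong V (V-odd y)) (trans (V-odd (b y)) (trans (cong (suc ∘ dbl) (idem (black< x≤))) (sym (V-odd y))))

    V-coloured : ∀ {x} → x ≤ dbl n → colour (V x) ≡ colour x
    V-coloured {x} _ with half x
    ... | even y = trans (cong colour (V-even y)) (trans (colour-dbl (W y)) (sym (colour-dbl y)))
    ... | odd y  = trans (cong colour (V-odd y)) (cong not (trans (colour-dbl (b y)) (sym (colour-dbl y))))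

    V-nc : ∀ {x y} → x < y → y ≤ dbl n → V x < V y → V y ≤ x → ⊥
    V-nc {x} {y} x<y y≤ Vx<Vy Vy≤x with half x | half y
    ... | even x | even y rewrite V-even x | V-even y =
      <-irrefl (trans Wx≡ (gapLabel-cong noncrossing (gapLabel-K noncrossing y))) W<
      where
      W< : W x < W y
      W< = dbl-cancel-< Vx<Vy
      Wx≡ : W x ≡ W (W y)
      Wx≡ = trans (sym (gapLabel-cong noncrossing (gapLabel-K noncrossing x)))
        (gapLabel-cong noncrossing (K-noncrossing {b} {n} W< (dbl-cancel-≤ (m≤n⇒m≤1+n Vy≤x)) (dbl-cancel-< x<y)
          (gapLabel-K noncrossing x) (gapLabel-K noncrossing y)))
    -- In both mixed cases a crossing would give an arc over exactly one of a gap and the least gap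
    -- of its class.
    ... | even x | odd y rewrite V-even x | V-odd y =
      <⇒≱ (proj₁ (proj₂ (gapLabel-K noncrossing x (black< y≤)) (dbl-cancel-< Vy≤x , dbl-cancel-≤ (<⇒≤ x<y))))
        (dbl-cancel-≤ (<⇒≤ Vx<Vy))
    ... | odd x | even y rewrite V-odd x | V-even y =
      <⇒≱ (dbl-cancel-< (<-trans (n<1+n _) x<y))
        (proj₂ (proj₁ (gapLabel-K noncrossing y (black< (≤-trans (<⇒≤ x<y) y≤)))
          (dbl-cancel-< (<-trans (n<1+n _) Vx<Vy) , dbl-cancel-≤ Vy≤x)))
    ... | odd x | odd y rewrite V-odd x | V-odd y =
      nc (dbl-cancel-< (≤-pred x<y)) (black< y≤) (dbl-cancel-< (≤-pred Vx<Vy)) (dbl-cancel-≤ (m≤n⇒m≤1+n (≤-pred Vy≤x)))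

    odd-label : ∀ {x y} → V y ≡ suc (dbl (b x)) → ∃[ z ] y ≡ suc (dbl z) × b z ≡ b x
    odd-label {x} {y} eq with half y
    ... | even z = ⊥-elim (dbl≢suc-dbl {W z} {b x} (trans (sym (V-even z)) eq))
    ... | odd z  = z , refl , dbl-injective (suc-injective (trans (sym (V-odd z)) eq))

    even-label : ∀ {x y} → V y ≡ dbl (W x) → ∃[ z ] y ≡ dbl z × W z ≡ W x
    even-label {x} {y} eq with half y
    ... | even z = z , refl , dbl-injective (trans (sym (V-even z)) eq)
    ... | odd z  = ⊥-elim (dbl≢suc-dbl {W x} {b z} (trans (sym eq) (V-odd z)))

    -- If gap x recurs, then point x is a minimum, as otherwise its own arc would cover gap x but no
    -- later gap. If point x recurs at z, then gap x + 1 is the least of its class: a smaller one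
    -- would, like gap x + 1, lie under the arc of z, hence under the arc of x, which does not reach
    -- gap x + 1.
    V-open⇒new : ∀ {x y} → x < y → y ≤ dbl n → V y ≡ V x → V (suc x) ≡ suc x
    V-open⇒new {x} {y} x<y y≤ eq with half x
    ... | even x with even-label {x} {y} (trans eq (V-even x))
    ...   | z , refl , Wz = trans (V-odd x) (cong (suc ∘ dbl) (≤-antisym (le x<n) (≮⇒≥ bx≮x)))
      where
      x<z : x < z
      x<z = dbl-cancel-< x<y
      x<n : x < n
      x<n = ≤-trans x<z (white≤ y≤)
      bx≮x : ¬ (b x < x)
      bx≮x bx<x = <⇒≱ x<z (proj₂ (proj₁ (gapLabel-reflects noncrossing (sym Wz) x<n) (bx<x , ≤-refl)))
    V-open⇒new {y = y} x<y y≤ eq | odd x with odd-label {x} {y} (trans eq (V-odd x))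
    ...   | z , refl , bz = trans (V-even (suc x)) (cong dbl (≤-antisym (gapLabel-≤ noncrossing (suc x)) (≮⇒≥ W≮)))
      where
      x<z : x < z
      x<z = dbl-cancel-< (≤-pred x<y)
      x<n : x < n
      x<n = <-trans x<z (black< y≤)
      W≮ : ¬ (W (suc x) < suc x)
      W≮ W<sx = <-irrefl refl (proj₂ (proj₁ (gapLabel-K noncrossing (suc x) x<n) (bx<W , ≤-pred W<sx)))
        where
        bx<W : b x < W (suc x)
        bx<W = subst (_< W (suc x)) bz (proj₁ (proj₂ (gapLabel-K noncrossing (suc x) (black< y≤))
          (subst (_< suc x) (sym bz) (s≤s (le x<n)) , x<z)))

    -- Both cases rest on `K-around-block`: the gap before a minimum recurs after the last element
    -- of that block, and the gap after a last element is never the least of its class.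
    V-new⇒open : ∀ {x} → x < dbl n → V (suc x) ≡ suc x → ∃[ y ] x < y × y ≤ dbl n × V y ≡ V x
    V-new⇒open {x} x< new with half x
    ... | even x with last-in-block noncrossing (dbl-cancel-< x<)
    ...   | m , x≤m , m<n , bm , lst = dbl (suc m) , <-trans (n<1+n _) (dbl-mono-< (s≤s x≤m)) , dbl-mono-≤ m<n ,
              trans (V-even (suc m)) (trans (cong dbl (sym (gapLabel-cong noncrossing kxm))) (sym (V-even x)))
      where
      bx : b x ≡ x
      bx = dbl-injective (suc-injective (trans (sym (V-odd x)) new))
      kxm : K b n x (suc m)
      kxm = subst (λ u → K b n u (suc m)) (trans bm bx)
        (K-around-block noncrossing m<n λ m<y y<n q → lst m<y y<n (trans q bm))
    V-new⇒open x< new | odd x with anyUpTo? (λ y → (x <? y) ×-dec (b y ≟ b x)) n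
    ... | yes (y , y<n , x<y , q) = suc (dbl y) , s≤s (<-trans (n<1+n _) (dbl-mono-< x<y)) , <⇒≤ (dbl-mono-< y<n) ,
            trans (V-odd y) (trans (cong (suc ∘ dbl) q) (sym (V-odd x)))
    ... | no none = ⊥-elim (<⇒≱ (s≤s (le x<n)) (subst (_≤ b x) W≡
            (gapLabel-minimal noncrossing (K-around-block noncrossing x<n λ {y} x<y y<n q → none (y , y<n , x<y , q)))))
      where
      x<n : x < n
      x<n = dbl-cancel-< (<-trans (n<1+n _) x<)
      W≡ : W (suc x) ≡ suc x
      W≡ = dbl-injective (trans (sym (V-even (suc x))) new)

    white-all : ∀ {x} → x ≤ n → OneOrDPlusOne (whiteSize b n x)
    white-all {suc x} x≤n = white x≤n
    white-all {zero} _ = subst OneOrDPlusOne (sym (cnt-cong 1 n λ y _ _ → does-cong (K? b n 0 y) (K? b n n y)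
        (K-trans {b} {n} {n} {0} {y} (K-sym {b} {n} {0} {n} (K-ends {b} {n})))
        (K-trans {b} {n} {0} {n} {y} (K-ends {b} {n}))))
      (subst (λ m → OneOrDPlusOne (whiteSize b n m)) (suc-pred-n 0<n) (white (subst (_≤ n) (sym (suc-pred-n 0<n)) ≤-refl)))
      where
      suc-pred-n : ∀ {n} → 0 < n → suc (pred n) ≡ n
      suc-pred-n (s≤s _) = refl

    V-size : ∀ {x} → x ≤ dbl n → OneOrDPlusOne (remaining V (V x) 1 (dbl n))
    V-size {x} x≤ with half x
    ... | odd x = subst (λ z → OneOrDPlusOne (remaining V z 1 (dbl n))) (sym (V-odd x)) (subst OneOrDPlusOne
            (sym (trans (remaining-black {V} {n} (b x) λ {y} _ → W (suc y) , V-even (suc y)) (black-size {V} {b} {n} (λ {y} _ → V-odd y) x<n)))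
            (black x<n))
      where x<n = black< x≤
    ... | even x = subst (λ z → OneOrDPlusOne (remaining V z 1 (dbl n))) (sym (V-even x)) (subst OneOrDPlusOne
            (sym (trans (remaining-white {V} {b} {n} (W x) λ {y} _ → V-odd y)
              (cnt-cong 1 n λ y _ _ → does-cong (_ ≟ _) (K? b n x y)
                (λ q → gapLabel-reflects noncrossing (sym (dbl-injective (trans (sym (V-even y)) q))))
                (λ k → trans (V-even y) (cong dbl (sym (gapLabel-cong noncrossing k)))))))
            (white-all (white≤ x≤)))

    extend-planar : Planar V (dbl n)
    extend-planar = record
      { le = V-le ; idem = V-idem ; coloured = V-coloured ; nc = V-nc
      ; open⇒new = V-open⇒new ; new⇒open = V-new⇒open ; size = V-size }

  module Restrict {V b n} (planar : Planar V (dbl n)) (ext : Extends V b n) where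
    private module P = Planar planar

    b-le : ∀ {z} → z < n → b z ≤ z
    b-le {z} z<n = dbl-cancel-≤ (m≤n⇒m≤1+n (≤-pred (subst (_≤ suc (dbl z)) (ext z<n) (P.le (<⇒≤ (dbl-mono-< z<n))))))

    restrict-noncrossing : Noncrossing b n
    restrict-noncrossing = record
      { le = b-le
      ; idem = λ {z} z<n → dbl-injective (suc-injective (trans (sym (ext (≤-<-trans (b-le z<n) z<n)))
          (trans (cong V (sym (ext z<n))) (trans (P.idem (<⇒≤ (dbl-mono-< z<n))) (ext z<n)))))
      ; nc = λ {x} {y} x<y y<n bx<by by≤x → P.nc (s≤s (<⇒≤ (dbl-mono-< x<y))) (<⇒≤ (dbl-mono-< y<n))
          (subst₂ _<_ (sym (ext (<-trans x<y y<n))) (sym (ext y<n)) (s≤s (<⇒≤ (dbl-mono-< bx<by))))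
          (subst (_≤ suc (dbl x)) (sym (ext y<n)) (s≤s (dbl-mono-≤ by≤x))) }

    white-label : ∀ {x} → x ≤ n → ∃[ u ] V (dbl x) ≡ dbl u
    white-label {x} x≤n = even-half (trans (P.coloured (dbl-mono-≤ x≤n)) (colour-dbl x))

    -- An arc over exactly one of two gaps with the same label would cross their white block,
    -- against `nc`.
    same-label⇒K : ∀ {x y} → x < y → y ≤ n → V (dbl x) ≡ V (dbl y) → K b n x y
    same-label⇒K {x} {y} x<y y≤n eq {z} z<n = to , from
      where
      label≤ : V (dbl y) ≤ dbl x
      label≤ = subst (_≤ dbl x) eq (P.le (dbl-mono-≤ (≤-trans (<⇒≤ x<y) y≤n)))
      L = proj₁ (white-label y≤n)
      L-eq : V (dbl y) ≡ dbl L
      L-eq = proj₂ (white-label y≤n)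
      L≤x : L ≤ x
      L≤x = dbl-cancel-≤ (m≤n⇒m≤1+n (subst (_≤ dbl x) L-eq label≤))
      to : Cov b z x → Cov b z y
      to (bz<x , x≤z) = <-trans bz<x x<y , ≮⇒≥ z≮y
        where
        z≮y : ¬ (z < y)
        z≮y z<y with L ≤? b z
        ... | yes L≤ = P.nc {dbl x} {suc (dbl z)} (s≤s (dbl-mono-≤ x≤z)) (<⇒≤ (dbl-mono-< z<n))
              (subst₂ _<_ (sym (trans eq L-eq)) (sym (ext z<n)) (s≤s (dbl-mono-≤ L≤)))
              (subst (_≤ dbl x) (sym (ext z<n)) (<⇒≤ (dbl-mono-< bz<x)))
        ... | no L≰ = P.nc {suc (dbl z)} {dbl y} (dbl-mono-< z<y) (dbl-mono-≤ y≤n)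
            (subst₂ _<_ (sym (ext z<n)) (sym L-eq) (dbl-mono-< (≰⇒> L≰)))
            (≤-trans label≤ (m≤n⇒m≤1+n (dbl-mono-≤ x≤z)))
      from : Cov b z y → Cov b z x
      from (bz<y , y≤z) = ≮⇒≥ x≮ , ≤-trans (<⇒≤ x<y) y≤z
        where
        x≮ : ¬ (x < suc (b z))
        x≮ x≤bz = P.nc {dbl y} {suc (dbl z)} (s≤s (dbl-mono-≤ y≤z)) (<⇒≤ (dbl-mono-< z<n))
          (subst₂ _<_ (sym L-eq) (sym (ext z<n)) (s≤s (dbl-mono-≤ (≤-trans L≤x (≤-pred x≤bz)))))
          (subst (_≤ dbl y) (sym (ext z<n)) (<⇒≤ (dbl-mono-< bz<y)))

    -- Here coarseness is used. No arc of point x separates the gaps, so x is a minimum and by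
    -- `new⇒open` the white block of gap x recurs at some gap w. If w is before y, the argument
    -- continues from w; if it is beyond y, then y lies below the white arc from x to w and has to
    -- join it. The number `k` bounds the distance of the gaps.
    K⇒same-label′ : ∀ k x y → y ≤ k + x → x < y → y ≤ n → K b n x y → V (dbl x) ≡ V (dbl y)
    K⇒same-label′ zero    x y y≤ x<y y≤n kxy = ⊥-elim (<⇒≱ x<y y≤)
    K⇒same-label′ (suc k) x (suc y′) y≤ x<y y≤n kxy
      with P.new⇒open {dbl x} (<-trans (n<1+n _) (dbl-mono-< x<n)) (trans (ext x<n) (cong (suc ∘ dbl) bx))
      where
      x<n : x < n
      x<n = ≤-trans x<y y≤n
      bx : b x ≡ x
      bx = ≤-antisym (b-le x<n) (≮⇒≥ λ bx<x → <⇒≱ x<y (proj₂ (proj₁ (kxy x<n) (bx<x , ≤-refl))))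
    ... | w , x<w , w≤n , Vw with even-half {w} (trans (sym (P.coloured w≤n)) (trans (cong colour Vw)
            (trans (P.coloured (dbl-mono-≤ (≤-trans (<⇒≤ x<y) y≤n))) (colour-dbl x))))
    ...   | w′ , refl with <-cmp w′ (suc y′)
    ...     | tri≈ _ refl _ = sym Vw
    ...     | tri< w<y _ _ = trans (sym Vw) (K⇒same-label′ k w′ (suc y′)
                (≤-trans y≤ (subst (_≤ k + w′) (+-suc k x) (+-monoʳ-≤ k (dbl-cancel-< x<w)))) w<y y≤n
                (K-trans {b} {n} {w′} {x} {suc y′} (K-sym {b} {n} {x} {w′} kxw) kxy))
      where
      kxw : K b n x w′
      kxw = same-label⇒K (dbl-cancel-< x<w) (dbl-cancel-≤ (m≤n⇒m≤1+n w≤n)) (sym Vw)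
    ...     | tri> _ _ y<w = conclude
      where
      y = suc y′
      x≤n : x ≤ n
      x≤n = ≤-trans (<⇒≤ x<y) y≤n
      -- If gap y opened its block, point y - 1 would recur at some z. The arc of z covers y, hence
      -- x, so the arc of y - 1, with the same minimum, would cover x but not y.
      not-new : V (dbl y) ≢ dbl y
      not-new new with P.new⇒open {suc (dbl y′)} (dbl-mono-< y≤n) new
      ... | z , y<z , z≤ , Vz with odd-half {z} (trans (sym (P.coloured z≤)) (trans (cong colour Vz)
              (trans (P.coloured (<⇒≤ (dbl-mono-< y≤n))) (cong not (colour-dbl y′)))))
      ...   | z′ , refl = <-irrefl refl (proj₂ (proj₁ (kxy y≤n)
                (subst (_< x) bz≡ (proj₁ (proj₂ (kxy z<n) (subst (_< y) (sym bz≡) (s≤s (b-le y≤n)) , dbl-cancel-< (≤-pred y<z)))) , ≤-pred x<y)))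
        where
        z<n : z′ < n
        z<n = dbl-cancel-< z≤
        bz≡ : b z′ ≡ b y′
        bz≡ = dbl-injective (suc-injective (trans (sym (ext z<n)) (trans Vz (ext y≤n))))
      u = proj₁ (white-label y≤n)
      Vy : V (dbl y) ≡ dbl u
      Vy = proj₂ (white-label y≤n)
      u<y : u < y
      u<y = dbl-cancel-< (subst (_< dbl y) Vy (≤∧≢⇒< (P.le (dbl-mono-≤ y≤n)) not-new))
      Vx≤ : V (dbl x) ≤ dbl x
      Vx≤ = P.le (dbl-mono-≤ x≤n)
      Vx≤Vy : V (dbl x) ≤ V (dbl y)
      Vx≤Vy = ≮⇒≥ λ lt → P.nc (<-trans (n<1+n _) (dbl-mono-< y<w)) w≤n (subst (V (dbl y) <_) (sym Vw) lt)
        (subst (_≤ dbl y) (sym Vw) (≤-trans Vx≤ (dbl-mono-≤ (<⇒≤ x<y))))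
      conclude : V (dbl x) ≡ V (dbl y)
      conclude with u ≤? x
      ... | yes u≤x = ≤-antisym Vx≤Vy (≮⇒≥ λ lt → P.nc (<-trans (n<1+n _) (dbl-mono-< x<y)) (dbl-mono-≤ y≤n) lt
                        (subst (_≤ dbl x) (sym Vy) (dbl-mono-≤ u≤x)))
      -- If the least gap u in the block of y lay beyond x, it would be equivalent to x and nearer
      -- than y; by induction its label u would be that of x, which is at most x.
      ... | no u≰x = ⊥-elim (u≰x (dbl-cancel-≤ (m≤n⇒m≤1+n (subst (_≤ dbl x) (trans same Vu) Vx≤))))
        where
        Vu : V (dbl u) ≡ dbl u
        Vu = trans (cong V (sym Vy)) (trans (P.idem (dbl-mono-≤ y≤n)) Vy)
        same : V (dbl x) ≡ V (dbl u)
        same = K⇒same-label′ k x u (≤-pred (≤-trans u<y y≤)) (≰⇒> u≰x) (≤-trans (<⇒≤ u<y) y≤n)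
          (K-trans {b} {n} {x} {y} {u} kxy (K-sym {b} {n} {u} {y} (same-label⇒K u<y y≤n (trans Vu (sym Vy)))))

    K⇒same-label : ∀ {x y} → x ≤ n → y ≤ n → K b n x y → V (dbl x) ≡ V (dbl y)
    K⇒same-label {x} {y} x≤n y≤n k with <-cmp x y
    ... | tri< x<y _ _ = K⇒same-label′ y x y (m≤m+n y x) x<y y≤n k
    ... | tri≈ _ refl _ = refl
    ... | tri> _ _ y<x = sym (K⇒same-label′ x y x (m≤m+n x y) y<x x≤n (K-sym {b} {n} {x} {y} k))

    label⇒K : ∀ {x y} → x ≤ n → y ≤ n → V (dbl x) ≡ V (dbl y) → K b n x y
    label⇒K {x} {y} x≤n y≤n eq with <-cmp x y
    ... | tri< x<y _ _ = same-label⇒K x<y y≤n eq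
    ... | tri≈ _ refl _ = K-refl {b} {n} {x}
    ... | tri> _ _ y<x = K-sym {b} {n} {y} {x} (same-label⇒K y<x x≤n (sym eq))

    restrict-balanced : Balanced b n
    restrict-balanced = record
      { noncrossing = restrict-noncrossing
      ; black = λ {x} x<n → subst OneOrDPlusOne
          (trans (cong (λ z → remaining V z 1 (dbl n)) (ext x<n))
            (trans (remaining-black {V} {n} (b x) λ y<n → white-label y<n) (black-size {V} {b} {n} ext x<n)))
          (P.size (<⇒≤ (dbl-mono-< x<n)))
      ; white = λ {x} x<n → let u , eq = white-label x<n in subst OneOrDPlusOne
          (trans (cong (λ z → remaining V z 1 (dbl n)) eq) (trans (remaining-white {V} {b} {n} u ext)
            (cnt-cong 1 n λ y _ y≤n → does-cong (_ ≟ _) (K? b n (suc x) y)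
              (λ q → label⇒K x<n (≤-pred y≤n) (trans eq (sym q)))
              (λ k → trans (sym (K⇒same-label x<n (≤-pred y≤n) k)) eq))))
          (P.size (dbl-mono-≤ x<n)) }

  -- Labels at points come from `b`; a label at a gap is the least gap of its `K`-class, and `K`
  -- depends on `b` alone.
  extension-unique : ∀ {V V′ b n} → Planar V (dbl n) → Extends V b n → Planar V′ (dbl n) → Extends V′ b n →
                     ∀ {x} → x ≤ dbl n → V x ≡ V′ x
  extension-unique {V} {V′} {b} {n} pl ext pl′ ext′ {x} x≤ with half x
  ... | odd y  = trans (ext (dbl-cancel-< x≤)) (sym (ext′ (dbl-cancel-< x≤)))
  ... | even y = ≤-antisym (below pl ext pl′ ext′) (below pl′ ext′ pl ext)
    where
    y≤n : y ≤ n
    y≤n = dbl-cancel-≤ (m≤n⇒m≤1+n x≤)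
    below : ∀ {V V′} → Planar V (dbl n) → Extends V b n → Planar V′ (dbl n) → Extends V′ b n → V (dbl y) ≤ V′ (dbl y)
    below {V} {V′} pl ext pl′ ext′ with Restrict.white-label pl′ ext′ y≤n
    ... | u , eq = subst₂ _≤_ (Restrict.K⇒same-label pl ext u≤n y≤n kuy) (sym eq) (Planar.le pl (dbl-mono-≤ u≤n))
      where
      u≤n : u ≤ n
      u≤n = ≤-trans (dbl-cancel-≤ (m≤n⇒m≤1+n (subst (_≤ dbl y) eq (Planar.le pl′ x≤)))) y≤n
      kuy : K b n u y
      kuy = Restrict.label⇒K pl′ ext′ u≤n y≤n (trans (cong V′ (sym eq)) (Planar.idem pl′ x≤))

-- From Boolean tests to propositions

∧⁻ : ∀ x y → T (x ∧ y) → T x × T y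
∧⁻ true y t = _ , t

∧⁺ : ∀ x y → T x → T y → T (x ∧ y)
∧⁺ true y _ t = t

all⁻ : ∀ {A : Set} (p : A → Bool) {xs x} → T (all p xs) → x ∈ xs → T (p x)
all⁻ p {y ∷ xs} t (here refl) = proj₁ (∧⁻ (p y) _ t)
all⁻ p {y ∷ xs} t (there x∈) = all⁻ p (proj₂ (∧⁻ (p y) _ t)) x∈

all⁺ : ∀ {A : Set} (p : A → Bool) {xs} → (∀ {x} → x ∈ xs → T (p x)) → T (all p xs)
all⁺ p {[]}     h = _
all⁺ p {x ∷ xs} h = ∧⁺ (p x) _ (h (here refl)) (all⁺ p (h ∘ there))

any⁻ : ∀ {A : Set} (p : A → Bool) xs → T (any p xs) → ∃[ x ] x ∈ xs × T (p x)
any⁻ p (x ∷ xs) t with p x in eq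
... | true  = x , here refl , subst T (sym eq) _
... | false with any⁻ p xs t
...   | y , y∈ , py = y , there y∈ , py

any⁺ : ∀ {A : Set} (p : A → Bool) {xs x} → x ∈ xs → T (p x) → T (any p xs)
any⁺ p {y ∷ xs} x∈ px with p y in eq
... | true = _
any⁺ p {y ∷ xs} (here refl) px | false = ⊥-elim (subst T eq px)
any⁺ p {y ∷ xs} (there x∈) px | false = any⁺ p x∈ px

crossing⁻ : ∀ p q r s t u → T (not (p ∧ q ∧ r ∧ s ∧ t ∧ not u)) → T p → T q → T r → T s → T t → T u
crossing⁻ true true true true true true _ _ _ _ _ _ = _

crossing⁺ : ∀ p q r s t u → (T p → T q → T r → T s → T t → T u) → T (not (p ∧ q ∧ r ∧ s ∧ t ∧ not u))
crossing⁺ false _ _ _ _ _ h = _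
crossing⁺ true false _ _ _ _ h = _
crossing⁺ true true false _ _ _ h = _
crossing⁺ true true true false _ _ h = _
crossing⁺ true true true true false _ h = _
crossing⁺ true true true true true true h = _
crossing⁺ true true true true true false h = h _ _ _ _ _

NoCrossing : {P : Set} → List P → (P → ℕ) → (P → P → Bool) → Set
NoCrossing pts pos R = ∀ {a b c e} → a ∈ pts → b ∈ pts → c ∈ pts → e ∈ pts →
  pos a < pos b → pos b < pos c → pos c < pos e → T (R a c) → T (R b e) → T (R a b)

noCrossing⁻ : ∀ {P : Set} (pts : List P) pos R → T (noCrossing pts pos R) → NoCrossing pts pos R
noCrossing⁻ pts pos R t {a} {b} {c} {e} a∈ b∈ c∈ e∈ ab bc ce Rac Rbe =
  crossing⁻ (pos a <ᵇ pos b) (pos b <ᵇ pos c) (pos c <ᵇ pos e) (R a c) (R b e) (R a b)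
    (all⁻ _ (all⁻ _ (all⁻ _ (all⁻ _ t a∈) b∈) c∈) e∈) (<⇒<ᵇ ab) (<⇒<ᵇ bc) (<⇒<ᵇ ce) Rac Rbe

noCrossing⁺ : ∀ {P : Set} (pts : List P) pos R → NoCrossing pts pos R → T (noCrossing pts pos R)
noCrossing⁺ pts pos R h = all⁺ _ λ {a} a∈ → all⁺ _ λ {b} b∈ → all⁺ _ λ {c} c∈ → all⁺ _ λ {e} e∈ →
  crossing⁺ (pos a <ᵇ pos b) (pos b <ᵇ pos c) (pos c <ᵇ pos e) (R a c) (R b e) (R a b)
    λ ab bc ce → h a∈ b∈ c∈ e∈ (<ᵇ⇒< _ _ ab) (<ᵇ⇒< _ _ bc) (<ᵇ⇒< _ _ ce)

length-filter-tabulate : ∀ {A : Set} {n} (g : Fin n → A) (p : A → Bool) q k → (∀ i → p (g i) ≡ q (k + toℕ i)) →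
                         length (filterᵇ p (tabulate g)) ≡ cnt q k n
length-filter-tabulate {n = zero} g p q k h = refl
length-filter-tabulate {n = suc n} g p q k h with p (g Fin.zero) | trans (h Fin.zero) (cong q (+-identityʳ k))
... | true  | eq rewrite sym eq = cong suc (length-filter-tabulate (g ∘ Fin.suc) p q (suc k) λ i → trans (h (Fin.suc i)) (cong q (+-suc k (toℕ i))))
... | false | eq rewrite sym eq = length-filter-tabulate (g ∘ Fin.suc) p q (suc k) λ i → trans (h (Fin.suc i)) (cong q (+-suc k (toℕ i)))

length-filter-allFin : ∀ {n} (p : Fin n → Bool) q k → (∀ i → p i ≡ q (k + toℕ i)) → length (filterᵇ p (allFin n)) ≡ cnt q k n
length-filter-allFin = length-filter-tabulate (λ i → i)

value : ∀ {m n} → Vec (Fin m) n → ℕ → ℕ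
value []ᵛ      x       = x
value (a ∷ᵛ v) zero    = toℕ a
value (a ∷ᵛ v) (suc x) = value v x

value-lookup : ∀ {m n} (v : Vec (Fin m) n) i → value v (toℕ i) ≡ toℕ (lookup v i)
value-lookup (a ∷ᵛ v) Fin.zero    = refl
value-lookup (a ∷ᵛ v) (Fin.suc i) = value-lookup v i

vecs-complete : ∀ {A : Set} {xs : List A} → (∀ x → x ∈ xs) → ∀ {k} (v : Vec A k) → v ∈ vecs xs k
vecs-complete h []ᵛ      = here refl
vecs-complete {xs = xs} h (_∷ᵛ_ {n = k} x v) = ∈-concatMap⁺ (λ x → map (x ∷ᵛ_) (vecs xs k))
  (Any.map (λ { refl → ∈-map⁺ (x ∷ᵛ_) (vecs-complete h v) }) (h x))

∈-points : ∀ {n} (p : Point n) → p ∈ points n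
∈-points {n} (i , c) = ∈-concatMap⁺ (λ i → (i , false) ∷ (i , true) ∷ []) (Any.map (λ { refl → pick c }) (∈-allFin i))
  where
  pick : ∀ c → (i , c) ∈ ((i , false) ∷ (i , true) ∷ [])
  pick false = here refl
  pick true  = there (here refl)

as-fin : ∀ {n} {P : ℕ → Set} → (∀ (i : Fin n) → P (toℕ i)) → ∀ {z} → z < n → P z
as-fin {P = P} h z<n = subst P (toℕ-fromℕ< z<n) (h (fromℕ< z<n))

module _ {n} (v : Labeling n) where

  private b = value v

  value-same : ∀ i j → T (sameBlock v i j) → b (toℕ i) ≡ b (toℕ j)
  value-same i j t = trans (value-lookup v i) (trans (cong toℕ (toWitness t)) (sym (value-lookup v j)))

  same-value : ∀ i j → b (toℕ i) ≡ b (toℕ j) → T (sameBlock v i j)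
  same-value i j eq = fromWitness (toℕ-injective (trans (sym (value-lookup v i)) (trans eq (value-lookup v j))))

  value-twice : ∀ i → b (b (toℕ i)) ≡ toℕ (lookup v (lookup v i))
  value-twice i = trans (cong b (value-lookup v i)) (value-lookup v (lookup v i))

  setPartition⁻ : T (isSetPartition v) → ∀ i → b (toℕ i) ≤ toℕ i × b (b (toℕ i)) ≡ b (toℕ i)
  setPartition⁻ t i with ∧⁻ (toℕ (lookup v i) <ᵇ suc (toℕ i)) _ (all⁻ _ t (∈-allFin i))
  ... | l , fix = subst (_≤ toℕ i) (sym (value-lookup v i)) (≤-pred (<ᵇ⇒< _ _ l)) ,
                  trans (value-twice i) (trans (cong toℕ (toWitness fix)) (sym (value-lookup v i)))

  setPartition⁺ : (∀ i → b (toℕ i) ≤ toℕ i × b (b (toℕ i)) ≡ b (toℕ i)) → T (isSetPartition v)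
  setPartition⁺ h = all⁺ _ {allFin n} λ {i} _ → ∧⁺ (toℕ (lookup v i) <ᵇ suc (toℕ i)) ⌊ lookup v (lookup v i) ≟ᶠ lookup v i ⌋
    (<⇒<ᵇ (s≤s (subst (_≤ toℕ i) (value-lookup v i) (proj₁ (h i)))))
    (fromWitness (toℕ-injective (trans (sym (value-twice i)) (trans (proj₂ (h i)) (value-lookup v i)))))

  noncrossing⁻ : T (isSetPartition v) → T (isNoncrossing v) → Noncrossing b n
  noncrossing⁻ sp ncv = record { le = le ; idem = idem ; nc = nc }
    where
    le : ∀ {z} → z < n → b z ≤ z
    le = as-fin {P = λ z → b z ≤ z} (proj₁ ∘ setPartition⁻ sp)
    idem : ∀ {z} → z < n → b (b z) ≡ b z
    idem = as-fin {P = λ z → b (b z) ≡ b z} (proj₂ ∘ setPartition⁻ sp)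
    nc : ∀ {x y} → x < y → y < n → b x < b y → b y ≤ x → ⊥
    nc {x} {y} x<y y<n bx<by by≤x = <⇒≢ bx<by (trans (sym (idem x<n)) (trans bα≡bβ (idem y<n)))
      where
      x<n : x < n
      x<n = <-trans x<y y<n
      bx<n : b x < n
      bx<n = ≤-<-trans (le x<n) x<n
      by<n : b y < n
      by<n = ≤-<-trans (le y<n) y<n
      by<x : b y < x
      by<x = ≤∧≢⇒< by≤x λ q → <⇒≢ bx<by (trans (cong b (sym q)) (idem y<n))
      conv : ∀ {z w} (z<n : z < n) (w<n : w < n) → b z ≡ b w → T (sameBlock v (fromℕ< z<n) (fromℕ< w<n))
      conv z<n w<n eq = same-value _ _ (trans (cong b (toℕ-fromℕ< z<n)) (trans eq (cong b (sym (toℕ-fromℕ< w<n)))))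
      pos : ∀ {z w} (z<n : z < n) (w<n : w < n) → z < w → toℕ (fromℕ< z<n) < toℕ (fromℕ< w<n)
      pos z<n w<n = subst₂ _<_ (sym (toℕ-fromℕ< z<n)) (sym (toℕ-fromℕ< w<n))
      bα≡bβ : b (b x) ≡ b (b y)
      bα≡bβ = trans (cong b (sym (toℕ-fromℕ< bx<n))) (trans (value-same _ _
        (noCrossing⁻ (allFin n) toℕ (sameBlock v) ncv (∈-allFin (fromℕ< bx<n)) (∈-allFin (fromℕ< by<n)) (∈-allFin (fromℕ< x<n)) (∈-allFin (fromℕ< y<n))
          (pos bx<n by<n bx<by) (pos by<n x<n by<x) (pos x<n y<n x<y) (conv bx<n x<n (idem x<n)) (conv by<n y<n (idem y<n))))
        (cong b (toℕ-fromℕ< by<n)))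

  noncrossing⁺ : Noncrossing b n → T (isSetPartition v) × T (isNoncrossing v)
  noncrossing⁺ nb = setPartition⁺ (λ i → le (toℕ<n i) , idem (toℕ<n i)) ,
    noCrossing⁺ (allFin n) toℕ (sameBlock v) λ {a} {b′} {c} {e} _ _ _ _ ab bc ce Rac Rbe →
      same-value a b′ (uncrossed (toℕ<n e) ab bc ce (value-same a c Rac) (value-same b′ e Rbe))
    where
    open Noncrossing nb
    uncrossed : ∀ {w x y z} → z < n → w < x → x < y → y < z → b w ≡ b y → b x ≡ b z → b w ≡ b x
    uncrossed {w} {x} {y} {z} z<n w<x x<y y<z eq₁ eq₂ with <-cmp (b w) (b x)
    ... | tri≈ _ q _ = q
    ... | tri< lt _ _ = ⊥-elim (nc y<z z<n (subst₂ _<_ eq₁ eq₂ lt) (subst (_≤ y) eq₂ (≤-trans (le (<-trans x<y (<-trans y<z z<n))) (<⇒≤ x<y))))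
    ... | tri> _ _ gt = ⊥-elim (nc x<y (<-trans y<z z<n) (subst (b x <_) eq₁ gt) (subst (_≤ x) eq₁ (≤-trans (le (<-trans w<x (<-trans x<y (<-trans y<z z<n)))) (<⇒≤ w<x))))

2*-even-odd : ∀ {x y} → x ≤ y → 2 * x < suc (2 * y)
2*-even-odd x≤y = s≤s (*-monoʳ-≤ 2 x≤y)

2*-odd-even : ∀ {x y} → x < y → suc (2 * x) < 2 * y
2*-odd-even {x} {y} x<y = ≤-trans (≤-reflexive (sym (*-suc 2 x))) (*-monoʳ-≤ 2 x<y)

2*-even-odd⁻ : ∀ {x y} → 2 * x < suc (2 * y) → x ≤ y
2*-even-odd⁻ lt = *-cancelˡ-≤ 2 (≤-pred lt)

2*-odd-even⁻ : ∀ {x y} → suc (2 * x) < 2 * y → x < y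
2*-odd-even⁻ {x} {y} lt = *-cancelˡ-< 2 x y (<-trans (n<1+n _) lt)

2*-odd-odd⁻ : ∀ {x y} → suc (2 * x) < suc (2 * y) → x < y
2*-odd-odd⁻ {x} {y} lt = *-cancelˡ-< 2 x y (≤-pred lt)

∨-not⁻ : ∀ x y → T (not x ∨ y) → T x → T y
∨-not⁻ true y t _ = t

∨-not⁺ : ∀ x y → (T x → T y) → T (not x ∨ y)
∨-not⁺ false y h = _
∨-not⁺ true  y h = h _

bool≡does : ∀ {P : Set} (x : Bool) (P? : Dec P) → (T x → P) → (P → T x) → x ≡ does P?
bool≡does true  P? to from = sym (dec-true P? (to _))
bool≡does false P? to from = sym (dec-false P? from)

-- The Kreweras dual is the partition into classes of gaps

module Dual {n} (v : Labeling n) (nb : Noncrossing (value v) n) where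
  open Noncrossing nb
  private b = value v

  K′ : Fin n → Fin n → Set
  K′ i j = K b n (suc (toℕ i)) (suc (toℕ j))

  IsDual : Labeling n → Set
  IsDual σ = ∀ i j → (T (sameBlock σ i j) → K′ i j) × (K′ i j → T (sameBlock σ i j))

  module _ (τ : Labeling n) (joint : T (jointlyNoncrossing v τ)) where

    no-crossing : NoCrossing (points n) position (joinRel v τ)
    no-crossing = noCrossing⁻ (points n) position (joinRel v τ) joint

    -- An arc over only one of i′ and j′ crosses the block of τ through them. Since `joinRel` never
    -- relates a point to a primed point, the conclusion of `no-crossing` is then empty.
    joint⇒K′< : ∀ {i j} → toℕ i < toℕ j → T (sameBlock τ i j) → K′ i j
    joint⇒K′< {i} {j} i<j t = as-fin {P = λ z → (Cov b z (suc (toℕ i)) → Cov b z (suc (toℕ j))) × (Cov b z (suc (toℕ j)) → Cov b z (suc (toℕ i)))}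
        λ f → to f , from f
      where
      root-same : ∀ f → T (sameBlock v (lookup v f) f)
      root-same f = same-value v _ _ (trans (cong b (sym (value-lookup v f))) (idem (toℕ<n f)))
      to : ∀ f → Cov b (toℕ f) (suc (toℕ i)) → Cov b (toℕ f) (suc (toℕ j))
      to f (bf≤i , i<f) = <-trans bf≤i (s≤s i<j) , ≰⇒> λ f≤j →
        no-crossing (∈-points (lookup v f , false)) (∈-points (i , true)) (∈-points (f , false)) (∈-points (j , true))
          (2*-even-odd (subst (_≤ toℕ i) (value-lookup v f) (≤-pred bf≤i))) (2*-odd-even i<f) (2*-even-odd f≤j)
          (root-same f) t
      from : ∀ f → Cov b (toℕ f) (suc (toℕ j)) → Cov b (toℕ f) (suc (toℕ i))
      from f (bf≤j , j<f) = s≤s (≮⇒≥ λ i<bf →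
        no-crossing (∈-points (i , true)) (∈-points (lookup v f , false)) (∈-points (j , true)) (∈-points (f , false))
          (2*-odd-even (subst (toℕ i <_) (value-lookup v f) i<bf))
          (2*-even-odd (subst (_≤ toℕ j) (value-lookup v f) (≤-pred bf≤j))) (2*-odd-even j<f)
          t (root-same f)) , <-trans i<j j<f

    joint⇒K′ : ∀ i j → T (sameBlock τ i j) → K′ i j
    joint⇒K′ i j t with <-cmp (toℕ i) (toℕ j)
    ... | tri< i<j _ _ = joint⇒K′< i<j t
    ... | tri≈ _ eq _ = subst (λ x → K b n (suc (toℕ i)) (suc x)) eq (K-refl {b} {n} {suc (toℕ i)})
    ... | tri> _ _ j<i = K-sym {b} {n} {suc (toℕ j)} {suc (toℕ i)}
            (joint⇒K′< j<i (same-value τ j i (sym (value-same τ i j t))))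

  dual⇒joint : ∀ σ → IsDual σ → T (jointlyNoncrossing v σ)
  dual⇒joint σ dual = noCrossing⁺ (points n) position (joinRel v σ) λ {p} {q} {r} {s} _ _ _ _ → uncrossed p q r s
    where
    -- Mixed crossings: `arc` treats those that start at a point of [n], `arc′` those that start at
    -- a primed point. In each, an arc would cover exactly one of two equivalent gaps.
    arc : ∀ {w x y z} → w ≤ x → x < y → y ≤ z → z < n → b w ≡ b y → ¬ K b n (suc x) (suc z)
    arc w≤x x<y y≤z z<n eq k = <⇒≱ (proj₂ (proj₁ (k y<n) (subst (_< suc _) eq (s≤s (≤-trans (le (≤-<-trans w≤x (<-trans x<y y<n))) w≤x)) , x<y))) y≤z
      where y<n = ≤-<-trans y≤z z<n
    arc′ : ∀ {w x y z} → w < x → x ≤ y → y < z → z < n → b x ≡ b z → ¬ K b n (suc w) (suc y)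
    arc′ {w} {x} {y} {z} w<x x≤y y<z z<n eq k = <⇒≱ (proj₂ (proj₁ (k x<n) (bx≤w , w<x))) x≤y
      where
      x<n : x < n
      x<n = ≤-<-trans x≤y (<-trans y<z z<n)
      bx≤w : b x < suc w
      bx≤w = subst (_< suc w) (sym eq) (proj₁ (proj₂ (k z<n) (subst (_< suc y) eq (s≤s (≤-trans (le x<n) x≤y)) , y<z)))
    uncrossed : ∀ p q r s → position p < position q → position q < position r → position r < position s →
                T (joinRel v σ p r) → T (joinRel v σ q s) → T (joinRel v σ p q)
    uncrossed (i , false) (j , false) (k , false) (l , false) ij jk kl ik jl =
      noCrossing⁻ (allFin n) toℕ (sameBlock v) (proj₂ (noncrossing⁺ v nb)) (∈-allFin i) (∈-allFin j) (∈-allFin k) (∈-allFin l)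
        (*-cancelˡ-< 2 _ _ ij) (*-cancelˡ-< 2 _ _ jk) (*-cancelˡ-< 2 _ _ kl) ik jl
    uncrossed (i , true) (j , true) (k , true) (l , true) ij jk kl ik jl =
      proj₂ (dual i j) (K-noncrossing {b} {n} (s≤s (2*-odd-odd⁻ ij)) (s≤s (<⇒≤ (2*-odd-odd⁻ jk))) (s≤s (2*-odd-odd⁻ kl))
        (proj₁ (dual i k) ik) (proj₁ (dual j l) jl))
    uncrossed (i , false) (j , true) (k , false) (l , true) ij jk kl ik jl =
      ⊥-elim (arc (2*-even-odd⁻ ij) (2*-odd-even⁻ jk) (2*-even-odd⁻ kl) (toℕ<n l) (value-same v i k ik) (proj₁ (dual j l) jl))
    uncrossed (i , true) (j , false) (k , true) (l , false) ij jk kl ik jl =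
      ⊥-elim (arc′ (2*-odd-even⁻ ij) (2*-even-odd⁻ jk) (2*-odd-even⁻ kl) (toℕ<n l) (value-same v j l jl) (proj₁ (dual i k) ik))

  private module DualClass = Class {λ x y → K b n (suc x) (suc y)} (λ x y → K? b n (suc x) (suc y))
                   (λ x → K-refl {b} {n} {suc x}) (λ x y → K-sym {b} {n} {suc x} {suc y})
                   (λ x y z → K-trans {b} {n} {suc x} {suc y} {suc z})

  kreweras : Labeling n
  kreweras = tabulateᵛ λ i → fromℕ< (≤-<-trans (DualClass.label-≤ (toℕ i)) (toℕ<n i))

  kreweras-value : ∀ i → value kreweras (toℕ i) ≡ DualClass.label (toℕ i)
  kreweras-value i = trans (value-lookup kreweras i) (trans (cong toℕ (lookup∘tabulate _ i)) (toℕ-fromℕ< _))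

  kreweras-dual : IsDual kreweras
  kreweras-dual i j =
    (λ t → DualClass.label-reflects (trans (sym (kreweras-value i)) (trans (value-same kreweras i j t) (kreweras-value j)))) ,
    (λ k → same-value kreweras i j (trans (kreweras-value i) (trans (DualClass.label-cong k) (sym (kreweras-value j)))))

  kreweras-setPartition : T (isSetPartition kreweras)
  kreweras-setPartition = setPartition⁺ kreweras λ i →
    subst (_≤ toℕ i) (sym (kreweras-value i)) (DualClass.label-≤ (toℕ i)) ,
    trans (cong (value kreweras) (value-lookup kreweras i)) (trans (kreweras-value (lookup kreweras i))
      (trans (cong DualClass.label (trans (sym (value-lookup kreweras i)) (kreweras-value i)))
        (trans (DualClass.label-cong (DualClass.label-related (toℕ i))) (sym (kreweras-value i)))))

  kreweras∈partitions : kreweras ∈ partitions n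
  kreweras∈partitions = ∈-filter⁺ (T? ∘ isSetPartition) (vecs-complete ∈-allFin kreweras) kreweras-setPartition

  -- Joint noncrossing bounds σ by `K`. For the converse, the explicit labeling `kreweras` is itself
  -- a competitor, so it refines the coarsest one.
  isKrewerasDual⁻ : ∀ σ → T (isKrewerasDual v σ) → IsDual σ
  isKrewerasDual⁻ σ t i j = joint⇒K′ σ joint i j , λ k →
    ∨-not⁻ (sameBlock kreweras i j) _ (all⁻ _ (all⁻ _ refined (∈-allFin i)) (∈-allFin j)) (proj₂ (kreweras-dual i j) k)
    where
    rest = proj₂ (∧⁻ (isSetPartition σ) _ t)
    joint : T (jointlyNoncrossing v σ)
    joint = proj₁ (∧⁻ (jointlyNoncrossing v σ) _ rest)
    refined : T (refines kreweras σ)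
    refined = ∨-not⁻ (jointlyNoncrossing v kreweras) _ (all⁻ _ (proj₂ (∧⁻ (jointlyNoncrossing v σ) _ rest)) kreweras∈partitions)
      (dual⇒joint kreweras kreweras-dual)

  kreweras-isKrewerasDual : T (isKrewerasDual v kreweras)
  kreweras-isKrewerasDual = ∧⁺ (isSetPartition kreweras) _ kreweras-setPartition
    (∧⁺ (jointlyNoncrossing v kreweras) _ (dual⇒joint kreweras kreweras-dual)
      (all⁺ _ {partitions n} λ {τ} _ → ∨-not⁺ (jointlyNoncrossing v τ) (refines τ kreweras) λ joint →
        all⁺ _ {allFin n} λ {i} _ → all⁺ _ {allFin n} λ {j} _ → ∨-not⁺ (sameBlock τ i j) (sameBlock kreweras i j)
          (proj₂ (kreweras-dual i j) ∘ joint⇒K′ τ joint i j)))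

-- The selected labelings are the balanced ones of the given rank

module Selection (e : ℕ) where
  open Machine e
  open Weighted e

  oneOrDPlusOne⁻ : ∀ s → T (oneOrDPlusOne d s) → OneOrDPlusOne s
  oneOrDPlusOne⁻ s t with s ≡ᵇ 1 in eq
  ... | true  = inj₁ (≡ᵇ-sound eq)
  ... | false = inj₂ (≡ᵇ⇒≡ s (suc d) t)

  oneOrDPlusOne⁺ : ∀ s → OneOrDPlusOne s → T (oneOrDPlusOne d s)
  oneOrDPlusOne⁺ _ (inj₁ refl) = _
  oneOrDPlusOne⁺ _ (inj₂ refl) = subst T (sym (≡ᵇ-true {d} refl)) _

  congOneMod⁺ : ∀ s → OneOrDPlusOne s → T (congOneMod d s)
  congOneMod⁺ _ (inj₁ refl) = fromWitness {a? = d ∣? 0} (d ∣0)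
  congOneMod⁺ _ (inj₂ refl) = fromWitness {a? = d ∣? (d + 0)} (subst (d ∣_) (sym (+-identityʳ d)) ∣-refl)

  module _ {n} (v : Labeling n) where
    private b = value v

    blockSize-black : ∀ i → blockSize v i ≡ blackSize b n (toℕ i)
    blockSize-black i = length-filter-allFin _ _ 0 λ j → bool≡does (sameBlock v i j) (_ ≟ _)
      (sym ∘ value-same v i j) (same-value v i j ∘ sym)

    blockSize-white : (nb : Noncrossing b n) (σ : Labeling n) → Dual.IsDual v nb σ → ∀ i →
                      blockSize σ i ≡ whiteSize b n (suc (toℕ i))
    blockSize-white nb σ dual i = length-filter-allFin _ _ 1 λ j → bool≡does (sameBlock σ i j) (K? b n (suc (toℕ i)) (suc (toℕ j)))
      (proj₁ (dual i j)) (proj₂ (dual i j))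

    selected⁻ : ∀ j → T (selected d j n v) → Balanced b n × numBlocks v + d * j ≡ n
    selected⁻ j t = record { noncrossing = nb ; black = black ; white = white } , ≡ᵇ⇒≡ _ n (proj₁ t₂)
      where
      t₁ = ∧⁻ (inNCd d v) _ t
      t₂ = ∧⁻ ((numBlocks v + d * j) ≡ᵇ n) _ (proj₂ t₁)
      t₃ = ∧⁻ (allBlocks v (oneOrDPlusOne d)) _ (proj₂ t₂)
      u₁ = ∧⁻ (isSetPartition v) _ (proj₁ t₁)
      u₂ = ∧⁻ (isNoncrossing v) _ (proj₂ u₁)
      nb : Noncrossing b n
      nb = noncrossing⁻ v (proj₁ u₁) (proj₁ u₂)
      black : ∀ {x} → x < n → OneOrDPlusOne (blackSize b n x)
      black = as-fin {P = λ x → OneOrDPlusOne (blackSize b n x)} λ i →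
        subst OneOrDPlusOne (blockSize-black i) (oneOrDPlusOne⁻ _ (all⁻ _ (proj₁ t₃) (∈-allFin i)))
      white : ∀ {x} → x < n → OneOrDPlusOne (whiteSize b n (suc x))
      white with any⁻ _ (partitions n) (proj₂ t₃)
      ... | σ , _ , s with ∧⁻ (isKrewerasDual v σ) _ s
      ...   | dual , sizes = as-fin {P = λ x → OneOrDPlusOne (whiteSize b n (suc x))} λ i →
              subst OneOrDPlusOne (blockSize-white nb σ (Dual.isKrewerasDual⁻ v nb σ dual) i) (oneOrDPlusOne⁻ _ (all⁻ _ sizes (∈-allFin i)))

    selected⁺ : ∀ j → Balanced b n → numBlocks v + d * j ≡ n → T (selected d j n v)
    selected⁺ j bal eq =
      ∧⁺ (inNCd d v) _
        (∧⁺ (isSetPartition v) _ (proj₁ (noncrossing⁺ v nb)) (∧⁺ (isNoncrossing v) _ (proj₂ (noncrossing⁺ v nb))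
          (∧⁺ (allBlocks v (congOneMod d)) _ (black (congOneMod d) congOneMod⁺) (dual (congOneMod d) congOneMod⁺))))
        (∧⁺ ((numBlocks v + d * j) ≡ᵇ n) _ (≡⇒≡ᵇ _ n eq)
          (∧⁺ (allBlocks v (oneOrDPlusOne d)) _ (black (oneOrDPlusOne d) oneOrDPlusOne⁺) (dual (oneOrDPlusOne d) oneOrDPlusOne⁺)))
      where
      nb = Balanced.noncrossing bal
      open Dual v nb
      black : ∀ P → (∀ s → OneOrDPlusOne s → T (P s)) → T (allBlocks v P)
      black P h = all⁺ (λ i → P (blockSize v i)) {allFin n} λ {i} _ →
        h _ (subst OneOrDPlusOne (sym (blockSize-black i)) (Balanced.black bal (toℕ<n i)))
      dual : ∀ P → (∀ s → OneOrDPlusOne s → T (P s)) → T (any (λ σ → isKrewerasDual v σ ∧ allBlocks σ P) (partitions n))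
      dual P h = any⁺ (λ σ → isKrewerasDual v σ ∧ allBlocks σ P) kreweras∈partitions
        (∧⁺ (isKrewerasDual v kreweras) _ kreweras-isKrewerasDual (all⁺ (λ i → P (blockSize kreweras i)) {allFin n} λ {i} _ →
          h _ (subst OneOrDPlusOne (sym (blockSize-white nb kreweras kreweras-dual i)) (Balanced.white bal (toℕ<n i)))))

-- Counting through injective relations

-- Pigeonhole: the partner of the first element is deleted from `ys`, and by injectivity no later
-- element has it as its partner.
length-mono : ∀ {A B : Set} (R : A → B → Set) {xs ys} → Unique xs → (∀ {x} → x ∈ xs → ∃[ y ] y ∈ ys × R x y) →
              (∀ {x x′ y} → R x y → R x′ y → x ≡ x′) → length xs ≤ length ys
length-mono R [] total inj = z≤n
length-mono R {x ∷ xs} (x∉ ∷ u) total inj with total (here refl)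
... | y , y∈ , Rxy with ∈-∃++ y∈
...   | l , r , refl = subst (length (x ∷ xs) ≤_) (sym (length-++-comm l (y ∷ r)))
        (s≤s (subst (length xs ≤_) (length-++-comm l r) (length-mono R u total′ inj)))
  where
  total′ : ∀ {x′} → x′ ∈ xs → ∃[ y′ ] y′ ∈ l ++ r × R x′ y′
  total′ x′∈ with total (there x′∈)
  ... | y′ , y′∈ , Rx′ with ∈-++⁻ l y′∈
  ...   | inj₁ ∈l = y′ , ∈-++⁺ˡ ∈l , Rx′
  ...   | inj₂ (there ∈r) = y′ , ∈-++⁺ʳ l ∈r , Rx′
  ...   | inj₂ (here refl) = ⊥-elim (All.lookup x∉ x′∈ (inj Rxy Rx′))

vecs-unique : ∀ {A : Set} {xs : List A} → Unique xs → ∀ k → Unique (vecs xs k)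
vecs-unique u zero = [] ∷ []
vecs-unique {A} {xs} u (suc k) = go u
  where
  go : ∀ {ys} → Unique ys → Unique (concatMap (λ x → map (x ∷ᵛ_) (vecs xs k)) ys)
  go [] = []
  go {y ∷ ys} (y∉ ∷ uys) = Uniq.++⁺ (Uniq.map⁺ ∷-injectiveʳ (vecs-unique u k)) (go uys) disjoint
    where
    disjoint : ∀ {v} → v ∈ map (y ∷ᵛ_) (vecs xs k) × v ∈ concatMap (λ x → map (x ∷ᵛ_) (vecs xs k)) ys → ⊥
    disjoint (v∈₁ , v∈₂) with ∈-map⁻ (y ∷ᵛ_) v∈₁
    ... | _ , _ , refl = All.lookup y∉ (Any.map (λ v∈ → let _ , _ , eq = ∈-map⁻ _ v∈ in ∷-injectiveˡ eq)
            (∈-concatMap⁻ (λ x → map (x ∷ᵛ_) (vecs xs k)) v∈₂)) refl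

cnt-complement : ∀ P p f → cnt P p f + cnt (not ∘ P) p f ≡ f
cnt-complement P p zero = refl
cnt-complement P p (suc f) with P p
... | true  = cong suc (cnt-complement P (suc p) f)
... | false = trans (+-suc _ _) (cong suc (cnt-complement P (suc p) f))

numBlocks≡cnt : ∀ {n} (v : Labeling n) → numBlocks v ≡ cnt (λ y → value v y ≡ᵇ y) 0 n
numBlocks≡cnt v = length-filter-allFin _ _ 0 λ i → bool≡does ⌊ lookup v i ≟ᶠ i ⌋ (_ ≟ _)
  (λ t → trans (value-lookup v i) (cong toℕ (toWitness t)))
  (λ eq → fromWitness (toℕ-injective (trans (sym (value-lookup v i)) eq)))

value-injective : ∀ {n} (v v′ : Labeling n) → (∀ {x} → x < n → value v x ≡ value v′ x) → v ≡ v′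
value-injective v v′ h = trans (sym (tabulate∘lookup v)) (trans (tabulate-cong λ i →
  toℕ-injective (trans (sym (value-lookup v i)) (trans (h (toℕ<n i)) (value-lookup v′ i)))) (tabulate∘lookup v′))

dbl≡+ : ∀ x → dbl x ≡ x + x
dbl≡+ zero    = refl
dbl≡+ (suc x) = cong suc (trans (cong suc (dbl≡+ x)) (sym (+-suc x x)))

-- Encoding partitions by words

module Encoding (e : ℕ) where
  open Simulation e
  open Weighted e
  open Selection e

  -- The leading bit records the size of the white block of position 0, which the machine finds
  -- already open and so does not choose.
  data RootRun (V : ℕ → ℕ) (M a : ℕ) : ℕ → List Bool → Set where
    small : ∀ {b w} → Run V opening 1 M (root 0) a b w → RootRun V M a b (false ∷ w)
    large : ∀ {b w} → Run V opening 1 M (root d) a b w → RootRun V M a (suc b) (true ∷ w)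

  rootWords : ℕ → ℕ → ℕ → List (List Bool)
  rootWords M a zero    = map (false ∷_) (words opening M (0 ∷ []) a 0)
  rootWords M a (suc b) = map (false ∷_) (words opening M (0 ∷ []) a (suc b)) ++ map (true ∷_) (words opening M (d ∷ []) a b)

  rootRun⇒∈ : ∀ {V M a b w} → RootRun V M a b w → w ∈ rootWords M a b
  rootRun⇒∈ {b = zero}  (small r) = ∈-map⁺ (false ∷_) (run⇒∈ r)
  rootRun⇒∈ {b = suc b} (small r) = ∈-++⁺ˡ (∈-map⁺ (false ∷_) (run⇒∈ r))
  rootRun⇒∈ {M = M} {a} {suc b} (large r) = ∈-++⁺ʳ (map (false ∷_) (words opening M (0 ∷ []) a (suc b))) (∈-map⁺ (true ∷_) (run⇒∈ r))

  ∈⇒rootRun : ∀ M a b {w} → w ∈ rootWords M a b → Σ[ V ∈ (ℕ → ℕ) ] RootRun V M a b w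
  ∈⇒rootRun M a zero w∈ with ∈-map⁻ (false ∷_) w∈
  ... | w′ , w′∈ , refl = let V , r = ∈⇒run opening 1 M (root 0) a 0 w′∈ in V , small r
  ∈⇒rootRun M a (suc b) w∈ with ∈-++⁻ (map (false ∷_) (words opening M (0 ∷ []) a (suc b))) w∈
  ... | inj₁ w∈₁ with ∈-map⁻ (false ∷_) w∈₁
  ...   | w′ , w′∈ , refl = let V , r = ∈⇒run opening 1 M (root 0) a (suc b) w′∈ in V , small r
  ∈⇒rootRun M a (suc b) w∈ | inj₂ w∈₂ with ∈-map⁻ (true ∷_) w∈₂
  ...   | w′ , w′∈ , refl = let V , r = ∈⇒run opening 1 M (root d) a b w′∈ in V , large r

  rootWords-unique : ∀ M a b → Unique (rootWords M a b)
  rootWords-unique M a zero    = Uniq.map⁺ ∷ᴸ-injectiveʳ (words-unique opening M (0 ∷ []) a 0)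
  rootWords-unique M a (suc b) = Uniq.++⁺
    (Uniq.map⁺ ∷ᴸ-injectiveʳ (words-unique opening M (0 ∷ []) a (suc b)))
    (Uniq.map⁺ ∷ᴸ-injectiveʳ (words-unique opening M (d ∷ []) a b))
    λ { (u , v) → case (∈-map⁻ (false ∷_) u , ∈-map⁻ (true ∷_) v) of λ { ((_ , _ , refl) , (_ , _ , ())) } }

  -- A small root leaves one black opening, at position 1; a large one owes d more. Together this is
  -- A + y A Aᵈ = A B.
  length-rootWords : ∀ M a b → M ≡ suc (suc ((d + d) * (a + b))) → ForestNumber (length (rootWords M a b)) 1 1 a b
  length-rootWords M a zero eq = forest-swap 1 1 0 a (forest-leaf 0 1 a
    (subst (λ L → ForestNumber L 0 1 0 a) (sym (length-map (false ∷_) (words opening M (0 ∷ []) a 0)))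
      (forest-swap 1 0 a 0 (count-opening M (0 ∷ []) a 0 eq))))
  length-rootWords M a (suc b) eq = forest-swap 1 1 (suc b) a
    (subst (λ L → ForestNumber L 1 1 (suc b) a)
      (sym (trans (length-++ (map (false ∷_) (words opening M (0 ∷ []) a (suc b))))
        (cong₂ _+_ (length-map (false ∷_) (words opening M (0 ∷ []) a (suc b))) (length-map (true ∷_) (words opening M (d ∷ []) a b)))))
      (forest-node 0 1 b a (forest-swap 1 0 a (suc b) (count-opening M (0 ∷ []) a (suc b) eq))
        (subst (λ s → ForestNumber (length (words opening M (d ∷ []) a b)) 0 s b a) (sym (+-suc d 0))
          (forest-swap (suc (d + 0)) 0 a b (count-opening M (d ∷ []) a b (trans eq (arith d a b)))))))
    where
    arith : ∀ d a b → suc (suc ((d + d) * (a + suc b))) ≡ suc (suc (d + d + 0) + (d + d) * (a + b))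
    arith = solve-∀

  rootRun-cong : ∀ {V V′ M a b w} → (∀ {x} → x ≤ M → V x ≡ V′ x) → RootRun V M a b w → RootRun V′ M a b w
  rootRun-cong h (small r) = small (run-cong (λ x _ x< → h (≤-pred x<)) r)
  rootRun-cong h (large r) = large (run-cong (λ x _ x< → h (≤-pred x<)) r)

  rootRun-values : ∀ {V V′ M a b w} → RootRun V M a b w → RootRun V′ M a b w → ∀ {x} → 1 ≤ x → x ≤ M → V x ≡ V′ x
  rootRun-values (small r) (small r′) 1≤x x≤M = run-values r r′ 1≤x (s≤s x≤M)
  rootRun-values (large r) (large r′) 1≤x x≤M = run-values r r′ 1≤x (s≤s x≤M)

  rootRun-sound : ∀ {V M a b w} → V 0 ≡ 0 → RootRun V M a b w → Planar V M
  rootRun-sound V0 (small r) = Sound.planar r V0 (inj₁ refl)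
  rootRun-sound V0 (large r) = Sound.planar r V0 (inj₂ refl)

  rootRun-word-unique : ∀ {V M a b w w′} → V 0 ≡ 0 → RootRun V M a b w → RootRun V M a b w′ → w ≡ w′
  rootRun-word-unique V0 (small r) (small r′) = cong (false ∷_) (run-word-unique r r′ (cons (s≤s z≤n) V0 refl []))
  rootRun-word-unique V0 (large r) (large r′) = cong (true ∷_) (run-word-unique r r′ (cons (s≤s z≤n) V0 refl []))
  rootRun-word-unique V0 (small r) (large r′) = case trans (sym (Sound.remaining-root r V0 (inj₁ refl))) (Sound.remaining-root r′ V0 (inj₂ refl)) of λ ()
  rootRun-word-unique V0 (large r) (small r′) = case trans (sym (Sound.remaining-root r V0 (inj₂ refl))) (Sound.remaining-root r′ V0 (inj₁ refl)) of λ ()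

  old-black : ∀ V x f → old V (suc (dbl x)) (dbl f) ≡ cnt (λ y → not (V (suc (dbl y)) ≡ᵇ suc (dbl y))) x f
  old-black V x zero    = refl
  old-black V x (suc f) = cong (bit (not (V (suc (dbl x)) ≡ᵇ suc (dbl x))) +_) (old-black V (suc x) f)

  module _ {n} (v : Labeling n) {V} (ext : Extends V (value v) n) where

    numBlocks+old : numBlocks v + old V 1 (dbl n) ≡ n
    numBlocks+old = trans (cong₂ _+_ (numBlocks≡cnt v) (trans (old-black V 0 n) (cnt-cong 0 n λ y _ y<n → cong not
      (does-cong (_ ≟ _) (value v y ≟ y)
        (λ q → dbl-injective (suc-injective (trans (sym (ext y<n)) q))) (λ q → trans (ext y<n) (cong (suc ∘ dbl) q))))))
      (cnt-complement (λ y → value v y ≡ᵇ y) 0 n)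

    -- The root frame is white and promises no black resumption, so the points that are not minima
    -- are exactly the d · a resumptions of large black blocks.
    run-numBlocks : ∀ {t a b w} → V 0 ≡ 0 → Run V opening 1 (dbl n) (root t) a b w → numBlocks v + d * a ≡ n
    run-numBlocks V0 r = trans (cong (numBlocks v +_) (sym (proj₁ (run-old r (cons (s≤s z≤n) V0 refl []))))) numBlocks+old

  -- `V` mediates between the two sides: `v` determines it up to position 2n and `w` from position 1
  -- on, which yields injectivity in either direction.
  Encodes : ∀ {n} → ℕ → ℕ → Labeling n → List Bool → Set
  Encodes {n} j i v w = Σ[ V ∈ (ℕ → ℕ) ] Planar V (dbl n) × Extends V (value v) n × RootRun V (dbl n) j i w

  planar-V0 : ∀ {V M} → Planar V M → V 0 ≡ 0
  planar-V0 pl = n≤0⇒n≡0 (Planar.le pl z≤n)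

  encodes-word-unique : ∀ {n j i} {v : Labeling n} {w w′} → Encodes j i v w → Encodes j i v w′ → w ≡ w′
  encodes-word-unique (V , pl , ext , r) (V′ , pl′ , ext′ , r′) =
    rootRun-word-unique (planar-V0 pl) r (rootRun-cong (extension-unique pl′ ext′ pl ext) r′)

  encodes-labeling-unique : ∀ {n j i} {v v′ : Labeling n} {w} → Encodes j i v w → Encodes j i v′ w → v ≡ v′
  encodes-labeling-unique {v = v} {v′} (V , pl , ext , r) (V′ , pl′ , ext′ , r′) = value-injective v v′ λ x<n →
    dbl-injective (suc-injective (trans (sym (ext x<n)) (trans (rootRun-values r r′ (s≤s z≤n) (<⇒≤ (dbl-mono-< x<n))) (ext′ x<n))))

  encode : ∀ {n} j i → n ≡ suc (d * (i + j)) → (v : Labeling n) → Balanced (value v) n → numBlocks v + d * j ≡ n →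
           ∃[ w ] w ∈ rootWords (dbl n) j i × Encodes j i v w
  encode {n} j i n≡ v bal nb = go (Complete.complete pl (<-≤-trans (s≤s z≤n) (dbl-mono-≤ 0<n)))
    where
    0<n : 0 < n
    0<n = subst (0 <_) (sym n≡) (s≤s z≤n)
    V = Extend.V bal 0<n
    pl : Planar V (dbl n)
    pl = Extend.extend-planar bal 0<n
    ext : Extends V (value v) n
    ext {x} _ = Extend.V-odd bal 0<n x
    a≡j : ∀ {t a b w} → Run V opening 1 (dbl n) (root t) a b w → a ≡ j
    a≡j {a = a} r = *-cancelˡ-≡ a j d (+-cancelˡ-≡ (numBlocks v) _ _ (trans (run-numBlocks v ext (planar-V0 pl) r) (sym nb)))
    dbl-n : dbl n ≡ suc (suc ((d + d) * (i + j)))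
    dbl-n = trans (cong dbl n≡) (trans (cong (suc ∘ suc) (dbl≡+ (d * (i + j)))) (cong (suc ∘ suc) (sym (*-distribʳ-+ (i + j) d d))))
    finish : ∀ {w} → RootRun V (dbl n) j i w → ∃[ w ] w ∈ rootWords (dbl n) j i × Encodes j i v w
    finish {w} r = w , rootRun⇒∈ r , V , pl , ext , r
    go : ∃[ t ] (t ≡ 0 ⊎ t ≡ d) × Complete.Runs pl opening 1 (dbl n) (root t) → ∃[ w ] w ∈ rootWords (dbl n) j i × Encodes j i v w
    go (t , inj₁ refl , a , b , w , r) with a≡j r
    ... | refl with *-cancelˡ-≡ (i + j) (j + b) (d + d) (suc-injective (suc-injective (trans (sym dbl-n) (run-length r))))
    ...   | eq with +-cancelˡ-≡ j i b (trans (+-comm j i) eq)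
    ...     | refl = finish (small r)
    go (t , inj₂ refl , a , b , w , r) with a≡j r
    -- A large root lengthens the run by 2d positions, just as a bit `true` inside it does, so it
    -- counts as one more large white block.
    ... | refl with *-cancelˡ-≡ (i + j) (j + suc b) (d + d)
                     (suc-injective (suc-injective (trans (sym dbl-n) (trans (run-length r) (arith d j b)))))
      where
      arith : ∀ d a b → suc (suc (d + d + 0) + (d + d) * (a + b)) ≡ suc (suc ((d + d) * (a + suc b)))
      arith = solve-∀
    ...   | eq with +-cancelˡ-≡ j i (suc b) (trans (+-comm j i) eq)
    ...     | refl = finish (large r)

  decode : ∀ {n} j i {w} → w ∈ rootWords (dbl n) j i →
           Σ[ v ∈ Labeling n ] Balanced (value v) n × numBlocks v + d * j ≡ n × Encodes j i v w
  decode {n} j i {w} w∈ = v , Restrict.restrict-balanced pl ext , blocks r , V , pl , ext , r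
    where
    found = ∈⇒rootRun (dbl n) j i w∈
    -- A run from position 1 says nothing about position 0, whose label is therefore set by hand.
    V = proj₁ found [ 0 ↦ 0 ]
    rootRun-update : RootRun (proj₁ found) (dbl n) j i w → RootRun V (dbl n) j i w
    rootRun-update (small r) = small (run-update r)
    rootRun-update (large r) = large (run-update r)
    r : RootRun V (dbl n) j i w
    r = rootRun-update (proj₂ found)
    pl : Planar V (dbl n)
    pl = rootRun-sound refl r
    black : (x : Fin n) → ∃[ u ] V (suc (dbl (toℕ x))) ≡ suc (dbl u)
    black x = odd-half (trans (Planar.coloured pl (<⇒≤ (dbl-mono-< (toℕ<n x)))) (cong not (colour-dbl (toℕ x))))
    black< : ∀ x → proj₁ (black x) < n
    black< x = ≤-<-trans (dbl-cancel-≤ (m≤n⇒m≤1+n (≤-pred (subst (_≤ suc (dbl (toℕ x))) (proj₂ (black x))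
      (Planar.le pl (<⇒≤ (dbl-mono-< (toℕ<n x)))))))) (toℕ<n x)
    v : Labeling n
    v = tabulateᵛ λ x → fromℕ< (black< x)
    ext : Extends V (value v) n
    ext = as-fin {P = λ x → V (suc (dbl x)) ≡ suc (dbl (value v x))} λ x → trans (proj₂ (black x)) (cong (suc ∘ dbl)
      (sym (trans (value-lookup v x) (trans (cong toℕ (lookup∘tabulate _ x)) (toℕ-fromℕ< (black< x))))))
    blocks : RootRun V (dbl n) j i w → numBlocks v + d * j ≡ n
    blocks (small r) = run-numBlocks v ext refl r
    blocks (large r) = run-numBlocks v ext refl r

  countSelected≡ : ∀ j i n → n ≡ suc (d * (i + j)) → countSelected d j n ≡ length (rootWords (dbl n) j i)
  countSelected≡ j i n n≡ = ≤-antisym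
    (length-mono (Encodes j i) (Uniq.filter⁺ (T? ∘ selected d j n) (Uniq.filter⁺ (T? ∘ isSetPartition) (vecs-unique (Uniq.allFin⁺ n) n)))
      (λ {v} v∈ → let bal , nb = selected⁻ v j (proj₂ (∈-filter⁻ (T? ∘ selected d j n) {xs = partitions n} v∈)) in encode j i n≡ v bal nb)
      encodes-labeling-unique)
    (length-mono (λ w v → Encodes j i v w) (rootWords-unique (dbl n) j i)
      (λ w∈ → let v , bal , nb , enc = decode j i w∈ in v ,
        ∈-filter⁺ (T? ∘ selected d j n)
          (∈-filter⁺ (T? ∘ isSetPartition) (vecs-complete ∈-allFin v) (proj₁ (noncrossing⁺ v (Balanced.noncrossing bal))))
          (selected⁺ v j bal nb) , enc)
      (λ {w} {w′} {v} → encodes-word-unique {n} {j} {i} {v} {w} {w′}))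

theorem4p6 : (d i j k : ℕ) → 1 ≤ d → i + j ≡ k →
    countSelected d j (d * k + 1) * ((d * j + 1) * (d * i + 1))
    ≡ (d * k + 1) * ((d * j + 1) C i) * ((d * i + 1) C j)
theorem4p6 (suc e) i j _ _ refl = trans
    (cong (_* ((suc e * j + 1) * (suc e * i + 1))) (countSelected≡ j i n (+-comm (suc e * (i + j)) 1)))
    (forest-closed (length (rootWords (dbl n) j i)) i j (length-rootWords (dbl n) j i dbl-n))
  where
  open Encoding e
  open Simulation e
  n = suc e * (i + j) + 1
  dbl-n : dbl n ≡ suc (suc ((suc e + suc e) * (j + i)))
  dbl-n = trans (dbl≡+ n) (arith (suc e) i j)
    where
    arith : ∀ d i j → (d * (i + j) + 1) + (d * (i + j) + 1) ≡ suc (suc ((d + d) * (j + i)))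
    arith = solve-∀
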